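{- Assume Dickson's conjecture. Then the set \[ \left\{ \frac{\varphi(p+1)}{\varphi(p-1)} \,:\, p \text{ and } p+2 \text{ are both prime} \right\} \] is dense in $[0,\infty)$.
   Context: $\varphi$ denotes Euler's totient function. Dickson's conjecture is the following assertion: if $f_1,\dots,f_k \in \mathbb{Z}[t]$ are linear polynomials with positive leading coefficients and the product $f=f_1f_2\cdots f_k$ does not vanish identically modulo any prime (i.e., for every prime $q$ there is an integer $t$ with $q \nmid f(t)$), then there are infinitely many positive integers $t$ for which $f_1(t),\dots,f_k(t)$ are simultaneously prime. -}

module Defs where

open import Data.Integer as ℤ using (ℤ; +_; 0ℤ; 1ℤ)
open import Data.Integer.Divisibility using () renaming (_∣_ to _∣ℤ_)
open import Data.List using (List; filter; foldr; length; map; upTo)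
open import Data.List.Membership.Propositional.Properties
  using (∈-filter⁺; ∈-length; ∈-map⁺; ∈-upTo⁺)
open import Data.List.Relation.Unary.All using (All)
open import Data.Nat as ℕ using (ℕ; suc; NonZero; NonTrivial; 2+; z<s; >-nonZero)
open import Data.Nat.Coprimality using (coprime?; 1-coprimeTo)
open import Data.Nat.Primality using (Prime; prime⇒nonTrivial)
open import Data.Product using (Σ; ∃; _×_)
open import Data.Rational as ℚ using (ℚ; 0ℚ; _/_)
open import Data.Rational.Properties as ℚ using ()
open import Level using (0ℓ)
open import Relation.Binary.PropositionalEquality using (_≡_; refl; sym; subst)
open import Relation.Nullary using (¬_)
open import Relation.Unary using (Pred; _∈_; _⊆_)

φ : ℕ → ℕ
φ n = length (filter (λ k → coprime? k n) (map suc (upTo n)))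

φ-nonZero : ∀ n → .{{NonZero n}} → NonZero (φ n)
φ-nonZero (suc n) = >-nonZero (∈-length
  (∈-filter⁺ (λ k → coprime? k (suc n)) (∈-map⁺ suc (∈-upTo⁺ z<s)) (1-coprimeTo (suc n))))

φ[p∸1]-nonZero : ∀ {p} → Prime p → NonZero (φ (p ℕ.∸ 1))
φ[p∸1]-nonZero {p} pp = lemma p {{prime⇒nonTrivial pp}}
  where
  lemma : ∀ m → .{{NonTrivial m}} → NonZero (φ (m ℕ.∸ 1))
  lemma (2+ m) = φ-nonZero (suc m)

totientRatio : ∀ p → Prime p → ℚ
totientRatio p pp = (+ φ (p ℕ.+ 1)) / φ (p ℕ.∸ 1)
  where instance _ = φ[p∸1]-nonZero pp

-- The polynomial  leading · t + constant  in ℤ[t], with leading > 0.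
record PositiveLinear : Set where
  field
    leading   : ℤ
    constant  : ℤ
    leading>0 : 0ℤ ℤ.< leading

open PositiveLinear public

eval : PositiveLinear → ℤ → ℤ
eval f t = leading f ℤ.* t ℤ.+ constant f

evalProduct : List PositiveLinear → ℤ → ℤ
evalProduct fs t = foldr (λ f r → eval f t ℤ.* r) 1ℤ fs

PrimeInteger : ℤ → Set
PrimeInteger z = ∃ λ p → Prime p × z ≡ + p

InfinitelyMany : Pred ℕ 0ℓ → Set
InfinitelyMany P = ∀ N → ∃ λ t → N ℕ.< t × P t

DicksonConjecture : Set
DicksonConjecture = (fs : List PositiveLinear) →
  (∀ q → Prime q → ∃ λ t → ¬ (+ q ∣ℤ evalProduct fs t)) →
  InfinitelyMany (λ t → All (λ f → PrimeInteger (eval f (+ t))) fs)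

-- Bishop's real numbers: sequences of rationals, the n-th term (counting from
-- n = 0) lying within 1/(n+1) of the limit.
record ℝ : Set where
  field
    approx  : ℕ → ℚ
    regular : ∀ m n → ℚ.∣ approx m ℚ.- approx n ∣ ℚ.≤ (+ 1 / suc m) ℚ.+ (+ 1 / suc n)

open ℝ public

fromℚ : ℚ → ℝ
fromℚ r .approx  _   = r
fromℚ r .regular m n = subst (ℚ._≤ (+ 1 / suc m) ℚ.+ (+ 1 / suc n)) (sym ∣r-r∣≡0)
  (ℚ.+-mono-≤ {0ℚ} {+ 1 / suc m} {0ℚ} {+ 1 / suc n} (0≤1/ m) (0≤1/ n))
  where
  ∣r-r∣≡0 : ℚ.∣ r ℚ.- r ∣ ≡ 0ℚ
  ∣r-r∣≡0 rewrite ℚ.+-inverseʳ r = refl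

  0≤1/ : ∀ k → 0ℚ ℚ.≤ + 1 / suc k
  0≤1/ k = ℚ.nonNegative⁻¹ (+ 1 / suc k) {{ℚ.normalize-nonNeg 1 (suc k)}}

infix 4 _≃_ _≤_

_≃_ : ℝ → ℝ → Set
x ≃ y = ∀ n → ℚ.∣ approx x n ℚ.- approx y n ∣ ℚ.≤ + 2 / suc n

_≤_ : ℝ → ℝ → Set
x ≤ y = ∀ n → approx x n ℚ.≤ approx y n ℚ.+ (+ 2 / suc n)

-- |x - y| < ε: the n-th approximations determine |x - y| up to 2/(n+1), so
-- the inequality holds exactly when some n certifies it.
∣_-_∣<_ : ℝ → ℝ → ℚ → Set
∣ x - y ∣< ε = ∃ λ n → ℚ.∣ approx x n ℚ.- approx y n ∣ ℚ.+ (+ 2 / suc n) ℚ.< ε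

_IsDenseIn_ : Pred ℝ 0ℓ → Pred ℝ 0ℓ → Set
A IsDenseIn B =
  A ⊆ B × (∀ x → x ∈ B → ∀ ε → 0ℚ ℚ.< ε → ∃ λ y → y ∈ A × ∣ x - y ∣< ε)

[0,∞⟩ : Pred ℝ 0ℓ
[0,∞⟩ x = fromℚ 0ℚ ≤ x

TwinPrimeTotientRatios : Pred ℝ 0ℓ
TwinPrimeTotientRatios y =
  ∃ λ p → Σ (Prime p) λ pp → Prime (p ℕ.+ 2) × y ≃ fromℚ (totientRatio p pp)

module Submission where

-- Write p − 1 = 2 m q₁ and p + 1 = 12 n q₂ with q₁, q₂ prime, where m and n are
-- products of distinct primes above 3 and 6 n is coprime to m. Solving
-- 6 n q₂ = 1 + m q₁ makes q₁, q₂, p and p + 2 linear in a parameter t without a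
-- common local obstruction, so Dickson's conjecture supplies arbitrarily large
-- q₁ and q₂, and then φ(p+1)/φ(p−1) tends to φ(12n) m / (φ(2m) 6n) =
-- (2/3) ∏_{ℓ∣n} (1 − 1/ℓ) / ∏_{ℓ∣m} (1 − 1/ℓ). Since ∏ (1 − 1/ℓ) over the primes
-- in (L, x] tends to 0 as x grows, m can be chosen to push this above any target
-- while n = 1, and then a greedy choice of primes dividing n, all large, brings
-- it down to the target with relative error at most 1/L. The product tends to 0
-- because sieving ∑_{k ≤ x} 1/k by a prime ℓ keeps at least the fraction
-- 1 − 1/ℓ of it, while sieving by all primes up to x leaves only k = 1.

open import Defs hiding (_≤_)
open import Data.Bool using (if_then_else_)
open import Data.Integer as ℤ using (ℤ)
open import Data.Integer.Divisibility using () renaming (_∣_ to _∣ℤ_)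
import Data.Integer.Properties as ℤ
open import Data.List using (List; []; _∷_; _++_; applyDownFrom; filter; length; map; upTo)
open import Data.List.Membership.Propositional using (_∈_)
open import Data.List.Membership.Propositional.Properties using (∈-applyDownFrom⁺; ∈-filter⁺)
open import Data.List.Properties using (filter-++; length-++; map-++; upTo-∷ʳ)
open import Data.List.Relation.Unary.All as All using (All; []; _∷_)
open import Data.List.Relation.Unary.All.Properties using (all-filter; applyDownFrom⁺₁; filter⁺)
open import Data.Nat
open import Data.Nat.Coprimality as Coprimality
  using (Coprime; coprime?; coprime-Bézout; coprime-divisor)
open import Data.Nat.Divisibility
open import Data.Nat.DivMod using (/-monoʳ-≤; m/n*n≡m; m/n*n≤m; m/n/o≡m/[n*o]; m/n≤m)
open import Data.Nat.GCD using (module Bézout)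
open import Data.Nat.ListAction using (product)
open import Data.Nat.ListAction.Properties using (product≢0; ∈⇒∣product)
open import Data.Nat.Primality
open import Data.Nat.Primality.Factorisation using (factorisationHasAllPrimeFactors; factorise)
open import Data.Nat.Properties
open import Data.Nat.Tactic.RingSolver using (solve-∀)
open import Data.Product using (Σ; ∃; ∃₂; _×_; _,_; proj₁; proj₂)
open import Data.Rational as ℚ using (ℚ; 0ℚ; mkℚ)
import Data.Rational.Properties as ℚ
open import Data.Rational.Solver using (module +-*-Solver)
open import Data.Rational.Unnormalised as ℚᵘ using (mkℚᵘ)
import Data.Rational.Unnormalised.Properties as ℚᵘ
open import Data.Sum using (inj₁; inj₂; [_,_]′)
open import Function using (_∘_)
open import Level using (Level)
open import Relation.Binary.PropositionalEquality
open import Relation.Nullary using (¬_; Dec; yes; no; does; contradiction)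
open import Relation.Unary using (Pred; Decidable)

private variable
  ℓ : Level
  P Q : Set ℓ
  d k m n p : ℕ
  ps : List ℕ

-- Sums over coprime residues and the totient

coprime-∣ : d ∣ k → Coprime k n → Coprime d n
coprime-∣ d∣k cop (e∣d , e∣n) = cop (∣-trans e∣d d∣k , e∣n)

coprime-*ʳ : Coprime k m → Coprime k n → Coprime k (m * n)
coprime-*ʳ k⊥m k⊥n (d∣k , d∣mn) = k⊥n (d∣k , coprime-divisor (coprime-∣ d∣k k⊥m) d∣mn)

prime≢1 : Prime p → p ≢ 1
prime≢1 pp refl = ¬prime[1] pp

prime∤⇒coprime : Prime p → p ∤ k → Coprime k p
prime∤⇒coprime pp p∤k (d∣k , d∣p) with prime⇒irreducible pp d∣p
... | inj₁ d≡1  = d≡1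
... | inj₂ refl = contradiction d∣k p∤k

∑ : ℕ → (ℕ → ℕ) → ℕ
∑ zero    f = 0
∑ (suc n) f = ∑ n f + f (suc n)

∑-mono-≤ : ∀ n {f g} → (∀ {k} → k < n → f (suc k) ≤ g (suc k)) → ∑ n f ≤ ∑ n g
∑-mono-≤ zero    f≤g = z≤n
∑-mono-≤ (suc n) f≤g = +-mono-≤ (∑-mono-≤ n (f≤g ∘ m<n⇒m<1+n)) (f≤g ≤-refl)

∑-cong : ∀ n {f g} → (∀ {k} → k < n → f (suc k) ≡ g (suc k)) → ∑ n f ≡ ∑ n g
∑-cong zero    f≡g = refl
∑-cong (suc n) f≡g = cong₂ _+_ (∑-cong n (f≡g ∘ m<n⇒m<1+n)) (f≡g ≤-refl)

∑-const : ∀ n c → ∑ n (λ _ → c) ≡ n * c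
∑-const zero    c = refl
∑-const (suc n) c = trans (cong (_+ c) (∑-const n c)) (+-comm (n * c) c)

∑-distrib-+ : ∀ n f g → ∑ n (λ k → f k + g k) ≡ ∑ n f + ∑ n g
∑-distrib-+ zero    f g = refl
∑-distrib-+ (suc n) f g rewrite ∑-distrib-+ n f g =
  interchange (∑ n f) (∑ n g) (f (suc n)) (g (suc n))
  where
  interchange : ∀ a b c d → a + b + (c + d) ≡ a + c + (b + d)
  interchange = solve-∀

*-distribˡ-∑ : ∀ c n f → c * ∑ n f ≡ ∑ n (λ k → c * f k)
*-distribˡ-∑ c zero    f = *-zeroʳ c
*-distribˡ-∑ c (suc n) f rewrite sym (*-distribˡ-∑ c n f) = *-distribˡ-+ c (∑ n f) (f (suc n))

∑-split : ∀ m n f → ∑ (m + n) f ≡ ∑ m f + ∑ n (λ k → f (m + k))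
∑-split m zero    f rewrite +-identityʳ m = sym (+-identityʳ _)
∑-split m (suc n) f rewrite +-suc m n | ∑-split m n f = +-assoc (∑ m f) _ _

∑-mono-length : ∀ f → m ≤ n → ∑ m f ≤ ∑ n f
∑-mono-length {m} f m≤n with m≤n⇒∃[o]m+o≡n m≤n
... | o , refl = subst (∑ m f ≤_) (sym (∑-split m o f)) (m≤m+n _ _)

infixl 5 _when_

-- An Iverson bracket: terms that fail the condition count as 0, so sums over sifted sets keep a
-- plain index range.
_when_ : ℕ → Dec P → ℕ
n when P? = if does P? then n else 0

when-yes : (P? : Dec P) → P → n when P? ≡ n
when-yes (yes _) p = refl
when-yes (no ¬p) p = contradiction p ¬p

when-no : (P? : Dec P) → ¬ P → n when P? ≡ 0
when-no (yes p) ¬p = contradiction p ¬p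
when-no (no _)  ¬p = refl

when-mono-≤ : (P? : Dec P) (Q? : Dec Q) → (P → Q) → m ≤ n → m when P? ≤ n when Q?
when-mono-≤ (no _)  Q? P⇒Q m≤n = z≤n
when-mono-≤ (yes p) Q? P⇒Q m≤n =
  ≤-trans m≤n (≤-reflexive (sym (when-yes Q? (P⇒Q p))))

when-cong : (P? : Dec P) (Q? : Dec Q) → (P → Q) → (Q → P) → n when P? ≡ n when Q?
when-cong P? Q? P⇒Q Q⇒P =
  ≤-antisym (when-mono-≤ P? Q? P⇒Q ≤-refl) (when-mono-≤ Q? P? Q⇒P ≤-refl)

*-when : ∀ c (P? : Dec P) → c * (n when P?) ≡ c * n when P?
*-when c (yes _) = refl
*-when c (no _)  = *-zeroʳ c

length-filter : ∀ {ℓ} {P : Pred ℕ ℓ} (P? : Decidable P) n →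
                length (filter P? (map suc (upTo n))) ≡ ∑ n (λ k → 1 when P? k)
length-filter P? zero    = refl
length-filter P? (suc n) = begin
  length (filter P? (map suc (upTo (suc n))))
    ≡⟨ cong (length ∘ filter P? ∘ map suc) (upTo-∷ʳ n) ⟨
  length (filter P? (map suc (upTo n ++ n ∷ [])))
    ≡⟨ cong (length ∘ filter P?) (map-++ suc (upTo n) (n ∷ [])) ⟩
  length (filter P? (map suc (upTo n) ++ suc n ∷ []))
    ≡⟨ cong length (filter-++ P? (map suc (upTo n)) (suc n ∷ [])) ⟩
  length (filter P? (map suc (upTo n)) ++ filter P? (suc n ∷ []))
    ≡⟨ length-++ (filter P? (map suc (upTo n))) ⟩
  length (filter P? (map suc (upTo n))) + length (filter P? (suc n ∷ []))
    ≡⟨ cong₂ _+_ (length-filter P? n) (singleton (suc n)) ⟩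
  ∑ (suc n) (λ k → 1 when P? k) ∎
  where
  open ≡-Reasoning
  singleton : ∀ k → length (filter P? (k ∷ [])) ≡ 1 when P? k
  singleton k with P? k
  ... | yes _ = refl
  ... | no _  = refl

-- Cut the range into `y` blocks of length `p`: in each block only the last index is a multiple of
-- `p`.
∑-multiples : ∀ p .{{_ : NonZero p}} y (f : ℕ → ℕ) →
              ∑ (y * p) (λ k → f k when (p ∣? k)) ≡ ∑ y (λ j → f (j * p))
∑-multiples p zero    f = refl
∑-multiples p@(suc p-1) (suc y) f = begin
  ∑ (p + y * p) h
    ≡⟨ cong (λ l → ∑ l h) (+-comm p (y * p)) ⟩
  ∑ (y * p + p) h
    ≡⟨ ∑-split (y * p) p h ⟩
  ∑ (y * p) h + (∑ p-1 (λ k → h (y * p + k)) + h (y * p + p))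
    ≡⟨ cong₂ _+_ (∑-multiples p y f) (cong₂ _+_
         (trans (∑-cong p-1 vanish) (trans (∑-const p-1 0) (*-zeroʳ p-1)))
         (when-yes (p ∣? (y * p + p)) (∣m∣n⇒∣m+n (n∣m*n y) ∣-refl))) ⟩
  ∑ y (λ j → f (j * p)) + f (y * p + p)
    ≡⟨ cong (λ k → ∑ y (λ j → f (j * p)) + f k) (+-comm (y * p) p) ⟩
  ∑ (suc y) (λ j → f (j * p)) ∎
  where
  open ≡-Reasoning
  h : ℕ → ℕ
  h k = f k when (p ∣? k)
  vanish : ∀ {k} → k < p-1 → h (y * p + suc k) ≡ 0
  vanish k<p-1 = when-no (p ∣? _) λ p∣ → >⇒∤ (s≤s k<p-1) (∣m+n∣m⇒∣n p∣ (n∣m*n y))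

∑-coprime : ℕ → ℕ → (ℕ → ℕ) → ℕ
∑-coprime n c f = ∑ n (λ k → f k when coprime? k c)

-- If `p ∤ k`, coprimality to `c` and to `p * c` agree; if `p ∣ k`, the first sum has no term at
-- `k`. This one identity serves both the totient and the harmonic sum.
∑-coprime-sieve : ∀ n c f → Prime p →
  ∑-coprime n c f ≡ ∑-coprime n (p * c) f + ∑ n (λ k → (f k when coprime? k c) when (p ∣? k))
∑-coprime-sieve {p} n c f pp =
  trans (∑-cong n (λ {k} _ → pointwise (suc k)))
        (∑-distrib-+ n (λ k → f k when coprime? k (p * c)) _)
  where
  pointwise : ∀ k → f k when coprime? k c ≡
    (f k when coprime? k (p * c)) + ((f k when coprime? k c) when (p ∣? k))
  pointwise k with p ∣? k
  ... | yes p∣k rewrite when-no {n = f k} (coprime? k (p * c))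
                          (λ k⊥pc → prime≢1 pp (k⊥pc (p∣k , m∣m*n c))) = refl
  ... | no  p∤k rewrite when-cong {n = f k} (coprime? k (p * c)) (coprime? k c)
                          (λ k⊥pc (d∣k , d∣c) → k⊥pc (d∣k , ∣n⇒∣m*n p d∣c))
                          (coprime-*ʳ (prime∤⇒coprime pp p∤k)) = sym (+-identityʳ _)

φ≡∑ : ∀ n → φ n ≡ ∑-coprime n n (λ _ → 1)
φ≡∑ n = length-filter (λ k → coprime? k n) n

-- Coprimality to `n` depends only on the residue modulo `n`, so each of the `q` periods contributes
-- `φ n`.
∑-coprime-periodic : ∀ q n → ∑-coprime (q * n) n (λ _ → 1) ≡ q * φ n
∑-coprime-periodic zero    n = refl
∑-coprime-periodic (suc q) n = begin
  ∑ (n + q * n) (λ k → 1 when coprime? k n)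
    ≡⟨ ∑-split n (q * n) _ ⟩
  ∑-coprime n n (λ _ → 1) + ∑ (q * n) (λ k → 1 when coprime? (n + k) n)
    ≡⟨ cong₂ _+_ (sym (φ≡∑ n)) (∑-cong (q * n) λ {k} _ → shift (suc k)) ⟩
  φ n + ∑-coprime (q * n) n (λ _ → 1)
    ≡⟨ cong (φ n +_) (∑-coprime-periodic q n) ⟩
  φ n + q * φ n ∎
  where
  open ≡-Reasoning
  shift : ∀ k → 1 when coprime? (n + k) n ≡ 1 when coprime? k n
  shift k = when-cong (coprime? (n + k) n) (coprime? k n)
    (λ cop (d∣k , d∣n) → cop (∣m∣n⇒∣m+n d∣n d∣k , d∣n))
    (λ cop (d∣n+k , d∣n) → cop (∣m+n∣m⇒∣n d∣n+k d∣n , d∣n))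

-- Up to `p * n` there are `p * φ n` numbers coprime to `n`. Sieving by `p` removes the multiples
-- `j * p`, and since `p ∤ n` these are coprime to `n` exactly when `j` is: `φ n` of them. Adding
-- `φ n` to both sides avoids subtraction.
φ-prime-* : Prime p → p ∤ n → φ (p * n) ≡ pred p * φ n
φ-prime-* {p} {n} pp p∤n = +-cancelʳ-≡ (φ n) _ _ (begin
  φ (p * n) + φ n
    ≡⟨ cong₂ _+_ (φ≡∑ (p * n)) (φ≡∑ n) ⟩
  ∑-coprime (p * n) (p * n) one + ∑-coprime n n one
    ≡⟨ cong (∑-coprime (p * n) (p * n) one +_) (sym multiples) ⟩
  ∑-coprime (p * n) (p * n) one + ∑ (p * n) (λ k → (1 when coprime? k n) when (p ∣? k))
    ≡⟨ ∑-coprime-sieve (p * n) n one pp ⟨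
  ∑-coprime (p * n) n one
    ≡⟨ ∑-coprime-periodic p n ⟩
  p * φ n
    ≡⟨ cong (_* φ n) (sym (suc-pred p)) ⟩
  φ n + pred p * φ n
    ≡⟨ +-comm (φ n) _ ⟩
  pred p * φ n + φ n ∎)
  where
  open ≡-Reasoning
  instance _ = prime⇒nonZero pp
  one : ℕ → ℕ
  one _ = 1
  n⊥p : Coprime n p
  n⊥p = prime∤⇒coprime pp p∤n
  multiples : ∑ (p * n) (λ k → (1 when coprime? k n) when (p ∣? k)) ≡ ∑-coprime n n one
  multiples = begin
    ∑ (p * n) (λ k → (1 when coprime? k n) when (p ∣? k))
      ≡⟨ cong (λ l → ∑ l (λ k → (1 when coprime? k n) when (p ∣? k))) (*-comm p n) ⟩
    ∑ (n * p) (λ k → (1 when coprime? k n) when (p ∣? k))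
      ≡⟨ ∑-multiples p n (λ k → 1 when coprime? k n) ⟩
    ∑ n (λ j → 1 when coprime? (j * p) n)
      ≡⟨ ∑-cong n (λ {j} _ → when-cong (coprime? (suc j * p) n) (coprime? (suc j) n)
           (coprime-∣ (m∣m*n p))
           (λ j⊥n (d∣jp , d∣n) → coprime-*ʳ {n} (λ (e∣n , e∣j) → j⊥n (e∣j , e∣n)) n⊥p (d∣n , d∣jp))) ⟩
    ∑-coprime n n one ∎

-- Sieving the harmonic sum

prime-divisor : ∀ n → 1 < n → ∃ λ p → Prime p × p ∣ n
prime-divisor n@(suc _) 1<n with factorise n
... | record { factors = [] ; isFactorisation = n≡1 } = contradiction (sym n≡1) (<⇒≢ 1<n)
... | record { factors = p ∷ ps ; isFactorisation = n≡ ; factorsPrime = pp ∷ _ } =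
  p , pp , subst (p ∣_) (sym n≡) (m∣m*n _)

-- For distinct primes this is the totient of `product ps`; divided by `product ps` it is ∏ (1 -
-- 1/p).
∏pred : List ℕ → ℕ
∏pred ps = product (map pred ps)

primes⇒product≢0 : All Prime ps → NonZero (product ps)
primes⇒product≢0 = product≢0 ∘ All.map prime⇒nonZero

primes⇒∏pred≢0 : All Prime ps → NonZero (∏pred ps)
primes⇒∏pred≢0 []         = _
primes⇒∏pred≢0 (pp ∷ pps) = m*n≢0 _ _ {{pred≢0 pp}} {{primes⇒∏pred≢0 pps}}
  where
  pred≢0 : ∀ {p} → Prime p → NonZero (pred p)
  pred≢0 {suc zero}    pp = contradiction pp ¬prime[1]
  pred≢0 {suc (suc _)} pp = _

infixl 7 _÷_

-- The junk value at zero is never summed.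
_÷_ : ℕ → ℕ → ℕ
D ÷ zero  = 0
D ÷ suc k = D / suc k

÷-antimono-≤ : ∀ D {m} → suc m ≤ n → D ÷ n ≤ D ÷ suc m
÷-antimono-≤ {suc n} D m≤n = /-monoʳ-≤ D m≤n

p*[D÷jp]≤D÷j : ∀ D j .{{_ : NonZero p}} → p * (D ÷ (suc j * p)) ≤ D ÷ suc j
p*[D÷jp]≤D÷j {p@(suc p-1)} D j = begin
  p * (D / (suc j * p))   ≡⟨ cong (p *_) (sym (m/n/o≡m/[n*o] D (suc j) p)) ⟩
  p * (D / suc j / p)     ≡⟨ *-comm p _ ⟩
  D / suc j / p * p       ≤⟨ m/n*n≤m (D / suc j) p ⟩
  D / suc j               ∎
  where open ≤-Reasoning

module _ (n D : ℕ) where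

  -- D ∑ 1/k over the k ≤ n coprime to `c`, with each term rounded down to stay in ℕ.
  harmonic : ℕ → ℕ
  harmonic c = ∑-coprime n c (D ÷_)

  -- The terms that sieving by `p` removes sit at k = j p, and each is at most 1/p times the term at
  -- j. So at most the fraction 1/p of the sum is lost.
  harmonic-prime-* : ∀ c → Prime p → pred p * harmonic c ≤ p * harmonic (p * c)
  harmonic-prime-* {p} c pp = +-cancelˡ-≤ (harmonic c) _ _ (begin
    harmonic c + pred p * harmonic c
      ≡⟨ cong (_* harmonic c) (suc-pred p) ⟩
    p * harmonic c
      ≡⟨ cong (p *_) (∑-coprime-sieve n c (D ÷_) pp) ⟩
    p * (harmonic (p * c) + ∑ n (λ k → (D ÷ k when coprime? k c) when (p ∣? k)))
      ≡⟨ *-distribˡ-+ p (harmonic (p * c)) _ ⟩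
    p * harmonic (p * c) + p * ∑ n (λ k → (D ÷ k when coprime? k c) when (p ∣? k))
      ≤⟨ +-monoʳ-≤ (p * harmonic (p * c)) multiples ⟩
    p * harmonic (p * c) + harmonic c
      ≡⟨ +-comm (p * harmonic (p * c)) _ ⟩
    harmonic c + p * harmonic (p * c) ∎)
    where
    open ≤-Reasoning
    instance _ = prime⇒nonZero pp
    term : ∀ j → p * (D ÷ (suc j * p) when coprime? (suc j * p) c) ≤ D ÷ suc j when coprime? (suc j) c
    term j = begin
      p * (D ÷ (suc j * p) when coprime? (suc j * p) c)
        ≡⟨ *-when p (coprime? (suc j * p) c) ⟩
      p * (D ÷ (suc j * p)) when coprime? (suc j * p) c
        ≤⟨ when-mono-≤ (coprime? (suc j * p) c) (coprime? (suc j) c)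
             (coprime-∣ (m∣m*n p)) (p*[D÷jp]≤D÷j {p} D j) ⟩
      D ÷ suc j when coprime? (suc j) c ∎
    multiples : p * ∑ n (λ k → (D ÷ k when coprime? k c) when (p ∣? k)) ≤ harmonic c
    multiples = begin
      p * ∑ n (λ k → (D ÷ k when coprime? k c) when (p ∣? k))
        -- The range is enlarged from `n` to `n * p` so that the multiples of `p` in it are indexed
        -- by all j ≤ n.
        ≤⟨ *-monoʳ-≤ p (∑-mono-length (λ k → (D ÷ k when coprime? k c) when (p ∣? k)) (m≤m*n n p)) ⟩
      p * ∑ (n * p) (λ k → (D ÷ k when coprime? k c) when (p ∣? k))
        ≡⟨ cong (p *_) (∑-multiples p n (λ k → D ÷ k when coprime? k c)) ⟩
      p * ∑ n (λ j → D ÷ (j * p) when coprime? (j * p) c)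
        ≡⟨ *-distribˡ-∑ p n (λ j → D ÷ (j * p) when coprime? (j * p) c) ⟩
      ∑ n (λ j → p * (D ÷ (j * p) when coprime? (j * p) c))
        ≤⟨ ∑-mono-≤ n (λ {j} _ → term j) ⟩
      harmonic c ∎

  harmonic-primes-* : ∀ c → All Prime ps →
                      ∏pred ps * harmonic c ≤ product ps * harmonic (product ps * c)
  harmonic-primes-* c [] = ≤-reflexive (cong (1 *_) (cong harmonic (sym (*-identityˡ c))))
  harmonic-primes-* {p ∷ ps} c (pp ∷ pps) = begin
    pred p * ∏pred ps * harmonic c
      ≡⟨ *-assoc (pred p) _ _ ⟩
    pred p * (∏pred ps * harmonic c)
      ≤⟨ *-monoʳ-≤ (pred p) (harmonic-primes-* c pps) ⟩
    pred p * (product ps * harmonic (product ps * c))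
      ≡⟨ rotate (pred p) (product ps) _ ⟩
    product ps * (pred p * harmonic (product ps * c))
      ≤⟨ *-monoʳ-≤ (product ps) (harmonic-prime-* (product ps * c) pp) ⟩
    product ps * (p * harmonic (p * (product ps * c)))
      ≡⟨ rotate (product ps) p _ ⟩
    p * (product ps * harmonic (p * (product ps * c)))
      ≡⟨ *-assoc p _ _ ⟨
    p * product ps * harmonic (p * (product ps * c))
      ≡⟨ cong (λ e → p * product ps * harmonic e) (sym (*-assoc p (product ps) c)) ⟩
    p * product ps * harmonic (p * product ps * c) ∎
    where
    open ≤-Reasoning
    rotate : ∀ a b c → a * (b * c) ≡ b * (a * c)
    rotate = solve-∀

-- Every k from 2 to `n` has a prime divisor at most `n`, which divides `c`; only the term `D` at k
-- = 1 survives.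
harmonic-sifted : ∀ n D c → (∀ {p} → Prime p → p ≤ n → p ∣ c) → harmonic n D c ≤ D
harmonic-sifted zero    D c sifted = z≤n
harmonic-sifted (suc n) D c sifted = begin
  ∑ (1 + n) term                              ≡⟨ ∑-split 1 n term ⟩
  term 1 + ∑ n (λ k → term (1 + k))           ≡⟨ cong (term 1 +_) (∑-cong n vanish) ⟩
  term 1 + ∑ n (λ _ → 0)                      ≡⟨ cong (term 1 +_) (trans (∑-const n 0) (*-zeroʳ n)) ⟩
  term 1 + 0                                  ≡⟨ +-identityʳ _ ⟩
  term 1                                      ≡⟨ when-yes (coprime? 1 c) (Coprimality.1-coprimeTo c) ⟩
  D / 1                                       ≤⟨ m/n≤m D 1 ⟩
  D                                           ∎
  where
  open ≤-Reasoning
  term : ℕ → ℕ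
  term k = D ÷ k when coprime? k c
  vanish : ∀ {k} → k < n → term (2+ k) ≡ 0
  vanish {k} k<n with prime-divisor (2+ k) (s≤s (s≤s z≤n))
  ... | p , pp , p∣k = when-no (coprime? (2+ k) c) λ k⊥c →
    prime≢1 pp (k⊥c (p∣k , sifted pp (≤-trans (∣⇒≤ p∣k) (s≤s k<n))))

-- Oresme's doubling argument: each of the `2 ^ i` terms with index in (2^i, 2^(i+1)] is at least D
-- / 2^(i+1), so the block contributes at least D/2. With D = 2^s these divisions are exact and
-- rounding costs nothing.
harmonic-grows : ∀ s i → i ≤ s → i * 2 ^ s ≤ 2 * ∑ (2 ^ i) (2 ^ s ÷_)
harmonic-grows s zero    i≤s = z≤n
harmonic-grows s (suc i) i<s = begin
  D + i * D
    ≡⟨ cong (_+ i * D) halves ⟩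
  2 * (2 ^ i * (D ÷ 2 ^ suc i)) + i * D
    ≤⟨ +-mono-≤ (*-monoʳ-≤ 2 upper) (harmonic-grows s i (<⇒≤ i<s)) ⟩
  2 * ∑ (2 ^ i) (λ k → D ÷ (2 ^ i + k)) + 2 * ∑ (2 ^ i) (D ÷_)
    ≡⟨ *-distribˡ-+ 2 (∑ (2 ^ i) (λ k → D ÷ (2 ^ i + k))) _ ⟨
  2 * (∑ (2 ^ i) (λ k → D ÷ (2 ^ i + k)) + ∑ (2 ^ i) (D ÷_))
    ≡⟨ cong (2 *_) (+-comm (∑ (2 ^ i) (λ k → D ÷ (2 ^ i + k))) _) ⟩
  2 * (∑ (2 ^ i) (D ÷_) + ∑ (2 ^ i) (λ k → D ÷ (2 ^ i + k)))
    ≡⟨ cong (2 *_) (∑-split (2 ^ i) (2 ^ i) (D ÷_)) ⟨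
  2 * ∑ (2 ^ i + 2 ^ i) (D ÷_)
    ≡⟨ cong (λ l → 2 * ∑ (2 ^ i + l) (D ÷_)) (+-identityʳ (2 ^ i)) ⟨
  2 * ∑ (2 ^ suc i) (D ÷_) ∎
  where
  open ≤-Reasoning
  D : ℕ
  D = 2 ^ s
  2^i∣D : 2 ^ suc i ∣ D
  2^i∣D = subst (λ e → 2 ^ suc i ∣ 2 ^ e) (m+[n∸m]≡n i<s)
    (subst (2 ^ suc i ∣_) (sym (^-distribˡ-+-* 2 (suc i) (s ∸ suc i))) (m∣m*n _))
  ÷-* : ∀ k → NonZero k → k ∣ D → k * (D ÷ k) ≡ D
  ÷-* (suc k) _ k∣D = trans (*-comm (suc k) _) (m/n*n≡m k∣D)
  halves : D ≡ 2 * (2 ^ i * (D ÷ 2 ^ suc i))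
  halves = trans (sym (÷-* (2 ^ suc i) (m^n≢0 2 (suc i)) 2^i∣D)) (*-assoc 2 (2 ^ i) _)
  upper : 2 ^ i * (D ÷ 2 ^ suc i) ≤ ∑ (2 ^ i) (λ k → D ÷ (2 ^ i + k))
  upper = begin
    2 ^ i * (D ÷ 2 ^ suc i)              ≡⟨ ∑-const (2 ^ i) _ ⟨
    ∑ (2 ^ i) (λ _ → D ÷ 2 ^ suc i)      ≤⟨ ∑-mono-≤ (2 ^ i) bound ⟩
    ∑ (2 ^ i) (λ k → D ÷ (2 ^ i + k))    ∎
    where
    bound : ∀ {k} → k < 2 ^ i → D ÷ 2 ^ suc i ≤ D ÷ (2 ^ i + suc k)
    bound {k} k<2^i rewrite +-suc (2 ^ i) k = ÷-antimono-≤ D (begin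
      suc (2 ^ i + k)      ≡⟨ +-suc (2 ^ i) k ⟨
      2 ^ i + suc k        ≤⟨ +-monoʳ-≤ (2 ^ i) k<2^i ⟩
      2 ^ i + 2 ^ i        ≡⟨ cong (2 ^ i +_) (sym (+-identityʳ _)) ⟩
      2 ^ suc i            ∎)

-- Primes in an interval and the smallness of ∏ (1 - 1/p)

primesAbove : ℕ → ℕ → List ℕ
primesAbove L k = filter prime? (applyDownFrom (λ i → suc (i + L)) k)

primesAbove-prime : ∀ L k → All Prime (primesAbove L k)
primesAbove-prime L k = all-filter prime? (applyDownFrom (λ i → suc (i + L)) k)

primesAbove-> : ∀ L k → All (L <_) (primesAbove L k)
primesAbove-> L k = filter⁺ prime? (applyDownFrom⁺₁ _ k λ {i} _ → s≤s (m≤n+m L i))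

primesAbove-< : ∀ L k → All (_< suc (k + L)) (primesAbove L k)
primesAbove-< L k = filter⁺ prime? (applyDownFrom⁺₁ _ k λ i<k → s≤s (+-monoˡ-< L i<k))

∈-primesAbove : ∀ {L k} → Prime p → L < p → p ≤ k + L → p ∈ primesAbove L k
∈-primesAbove {p} {L} {k} pp L<p p≤k+L with m≤n⇒∃[o]m+o≡n L<p
... | o , refl = ∈-filter⁺ prime?
  (subst (_∈ applyDownFrom (λ i → suc (i + L)) k) (cong suc (+-comm o L))
    (∈-applyDownFrom⁺ (λ i → suc (i + L))
      (+-cancelʳ-≤ L (suc o) k (subst (λ e → suc e ≤ k + L) (+-comm L o) p≤k+L)))) pp

-- Sieve the harmonic sum up to D by the primes at most `L` and then by those in (L, D]. At most `D`
-- remains, whereas the full sum is at least `K * Πs * D`; the factor `Πs` pays for the small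
-- primes, and the large ones must account for `K`.
primesAbove-sparse : ∀ L K → ∃ λ k → K * ∏pred (primesAbove L k) ≤ product (primesAbove L k)
primesAbove-sparse L K = len ,
  *-cancelˡ-≤ (Πs * D) {{m*n≢0 Πs D {{primes⇒product≢0 small-prime}} {{m^n≢0 2 s}}}} (begin
    Πs * D * (K * ∏pred big)
      ≡⟨ shuffle₁ Πs D K (∏pred big) ⟩
    ∏pred big * (K * Πs * D)
      ≤⟨ *-monoʳ-≤ (∏pred big) large ⟩
    ∏pred big * harmonic D D 1
      ≤⟨ *-monoʳ-≤ (∏pred big) (m≤n*m _ (∏pred small) {{primes⇒∏pred≢0 small-prime}}) ⟩
    ∏pred big * (∏pred small * harmonic D D 1)
      ≤⟨ *-monoʳ-≤ (∏pred big) (harmonic-primes-* D D 1 small-prime) ⟩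
    ∏pred big * (Πs * harmonic D D (Πs * 1))
      ≡⟨ shuffle₂ (∏pred big) Πs _ ⟩
    Πs * (∏pred big * harmonic D D (Πs * 1))
      ≤⟨ *-monoʳ-≤ Πs (harmonic-primes-* D D (Πs * 1) (primesAbove-prime L len)) ⟩
    Πs * (product big * harmonic D D (product big * (Πs * 1)))
      ≤⟨ *-monoʳ-≤ Πs (*-monoʳ-≤ (product big) (harmonic-sifted D D _ sifted)) ⟩
    Πs * (product big * D)
      ≡⟨ shuffle₃ Πs (product big) D ⟩
    Πs * D * product big ∎)
  where
  open ≤-Reasoning
  small : List ℕ
  small = primesAbove 0 L
  small-prime : All Prime small
  small-prime = primesAbove-prime 0 L
  Πs s D len : ℕ
  Πs = product small
  -- The first summand makes the harmonic sum, at least s D / 2, as large as `K * Πs * D`; the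
  -- summand `L` ensures L ≤ 2^s, so that `D ∸ L` is a true difference.
  s = 2 * (K * Πs) + L
  D = 2 ^ s
  len = D ∸ L
  big : List ℕ
  big = primesAbove L len
  n≤2^n : ∀ n → n ≤ 2 ^ n
  n≤2^n zero    = z≤n
  n≤2^n (suc n) = begin
    1 + n            ≤⟨ +-mono-≤ (m^n>0 2 n) (n≤2^n n) ⟩
    2 ^ n + 2 ^ n    ≡⟨ cong (2 ^ n +_) (sym (+-identityʳ _)) ⟩
    2 ^ suc n        ∎
  L≤D : L ≤ D
  L≤D = ≤-trans (m≤n+m L (2 * (K * Πs))) (n≤2^n s)
  large : K * Πs * D ≤ harmonic D D 1
  large = *-cancelˡ-≤ 2 (begin
    2 * (K * Πs * D)       ≡⟨ *-assoc 2 (K * Πs) D ⟨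
    2 * (K * Πs) * D       ≤⟨ *-monoˡ-≤ D (m≤m+n (2 * (K * Πs)) L) ⟩
    s * D                  ≤⟨ harmonic-grows s s ≤-refl ⟩
    2 * ∑ D (D ÷_)         ≡⟨ cong (2 *_) (∑-cong D λ {k} _ →
                                when-yes (coprime? (suc k) 1) (Coprimality.sym (Coprimality.1-coprimeTo _))) ⟨
    2 * harmonic D D 1     ∎)
  sifted : ∀ {p} → Prime p → p ≤ D → p ∣ product big * (Πs * 1)
  sifted {p} pp p≤D with p ≤? L
  ... | yes p≤L = ∣n⇒∣m*n (product big) (∣m⇒∣m*n 1 (∈⇒∣product
    (∈-primesAbove pp (>-nonZero⁻¹ p {{prime⇒nonZero pp}}) (subst (p ≤_) (sym (+-identityʳ L)) p≤L))))
  ... | no  p≰L = ∣m⇒∣m*n (Πs * 1) (∈⇒∣product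
    (∈-primesAbove pp (≰⇒> p≰L) (subst (p ≤_) (sym (m∸n+n≡m L≤D)) p≤D)))
  shuffle₁ : ∀ a b c d → a * b * (c * d) ≡ d * (c * a * b)
  shuffle₁ = solve-∀
  shuffle₂ : ∀ a b c → a * (b * c) ≡ b * (a * c)
  shuffle₂ = solve-∀
  shuffle₃ : ∀ a b c → a * (b * c) ≡ a * c * b
  shuffle₃ = solve-∀

-- Products of distinct primes and the greedy choice

data DistinctPrimes∤ (c : ℕ) : List ℕ → Set where
  []  : DistinctPrimes∤ c []
  -- One non-divisibility says both that `p` is absent from the tail and that it does not divide
  -- `c`; it is the hypothesis that `φ-prime-*` needs.
  _∷_ : Prime p × p ∤ product ps * c → DistinctPrimes∤ c ps → DistinctPrimes∤ c (p ∷ ps)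

distinct⇒prime : ∀ {c} → DistinctPrimes∤ c ps → All Prime ps
distinct⇒prime []              = []
distinct⇒prime ((pp , _) ∷ ds) = pp ∷ distinct⇒prime ds

φ-product-* : ∀ {c} → DistinctPrimes∤ c ps → φ (product ps * c) ≡ ∏pred ps * φ c
φ-product-* {c = c} [] = trans (cong φ (*-identityˡ c)) (sym (*-identityˡ (φ c)))
φ-product-* {p ∷ ps} {c} ((pp , p∤) ∷ ds) = begin
  φ (p * product ps * c)         ≡⟨ cong φ (*-assoc p (product ps) c) ⟩
  φ (p * (product ps * c))       ≡⟨ φ-prime-* pp p∤ ⟩
  pred p * φ (product ps * c)    ≡⟨ cong (pred p *_) (φ-product-* ds) ⟩
  pred p * (∏pred ps * φ c)      ≡⟨ *-assoc (pred p) (∏pred ps) (φ c) ⟨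
  pred p * ∏pred ps * φ c        ∎
  where open ≡-Reasoning

coprime-product : ∀ {c} → DistinctPrimes∤ c ps → Coprime c (product ps)
coprime-product []                      = Coprimality.sym (Coprimality.1-coprimeTo _)
coprime-product {p ∷ ps} ((pp , p∤) ∷ ds) =
  coprime-*ʳ (prime∤⇒coprime pp (p∤ ∘ ∣n⇒∣m*n (product ps))) (coprime-product ds)

-- The list is decreasing, so its head exceeds every prime factor of the product of its tail; it
-- also exceeds `L`, hence `c`.
primesAbove-distinct : ∀ {c L} .{{_ : NonZero c}} → c ≤ L → ∀ k → DistinctPrimes∤ c (primesAbove L k)
primesAbove-distinct c≤L zero = []
primesAbove-distinct {c} {L} c≤L (suc k) with prime? (suc (k + L))
... | no  _  = primesAbove-distinct c≤L k
... | yes pp = (pp , p∤) ∷ primesAbove-distinct c≤L k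
  where
  p∤ : suc (k + L) ∤ product (primesAbove L k) * c
  p∤ p∣ with euclidsLemma (product (primesAbove L k)) c pp p∣
  ... | inj₁ p∣Π = <-irrefl refl
    (All.lookup (primesAbove-< L k) (factorisationHasAllPrimeFactors pp p∣Π (primesAbove-prime L k)))
  ... | inj₂ p∣c = >⇒∤ (s≤s (≤-trans c≤L (m≤n+m L k))) p∣c

-- Drop primes from the front until the inequality turns; `p` is the last one dropped. Restoring `p`
-- would turn it back, so X ∏pred / (Y product) lies between 1 and p/(p - 1), an error controlled by
-- `L < p`.
greedy : ∀ {c L X Y} → DistinctPrimes∤ c ps → All (L <_) ps →
         Y ≤ X → X * ∏pred ps < Y * product ps →
         ∃₂ λ p qs → L < p × DistinctPrimes∤ c qs ×
           Y * product qs ≤ X * ∏pred qs × X * ∏pred (p ∷ qs) < Y * product (p ∷ qs)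
greedy {X = X} {Y} [] [] Y≤X X<Y rewrite *-identityʳ X | *-identityʳ Y = contradiction Y≤X (<⇒≱ X<Y)
greedy {p ∷ ps} {X = X} {Y} (_ ∷ ds) (L<p ∷ L<ps) Y≤X X<Y with Y * product ps ≤? X * ∏pred ps
... | yes Y≤X′ = p , ps , L<p , ds , Y≤X′ , X<Y
... | no  Y≰X′ = greedy ds L<ps Y≤X (≰⇒> Y≰X′)

-- Dickson's conjecture for q₁, q₂, p and p + 2

coprime⇒inverse : ∀ a b .{{_ : NonZero a}} .{{_ : NonZero b}} →
                  Coprime a b → ∃₂ λ x y → a * x ≡ 1 + b * y
coprime⇒inverse a@(suc a-1) b@(suc b-1) a⊥b with coprime-Bézout a⊥b
... | Bézout.+- x y eq = x , y , trans (*-comm a x) (trans (sym eq) (cong suc (*-comm y b)))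
-- Here a x ≡ -1 modulo b, so x is multiplied by b - 1 ≡ -1. The added `b` turns the quotient y (b -
-- 1) - 1 into y (b - 1) + (a - 1), which is a natural number.
... | Bézout.-+ x y eq = x * b-1 + b , y * b-1 + a-1 , +-cancelʳ-≡ b-1 _ _ (begin
  a * (x * b-1 + b) + b-1             ≡⟨ expandˡ a x b-1 ⟩
  (1 + x * a) * b-1 + a * b           ≡⟨ cong (λ e → e * b-1 + a * b) eq ⟩
  y * b * b-1 + a * b                 ≡⟨ expandʳ a-1 b-1 y ⟩
  1 + b * (y * b-1 + a-1) + b-1       ∎)
  where
  open ≡-Reasoning
  expandˡ : ∀ a x b-1 → a * (x * b-1 + suc b-1) + b-1 ≡ (1 + x * a) * b-1 + a * suc b-1
  expandˡ = solve-∀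
  expandʳ : ∀ a-1 b-1 y → y * suc b-1 * b-1 + suc a-1 * suc b-1 ≡ 1 + suc b-1 * (y * b-1 + a-1) + b-1
  expandʳ = solve-∀

∣m+n∣n⇒∣m : d ∣ m + n → d ∣ n → d ∣ m
∣m+n∣n⇒∣m {d} {m} {n} d∣m+n = ∣m+n∣m⇒∣n (subst (d ∣_) (+-comm m n) d∣m+n)

prime∤1 : Prime p → p ∤ 1
prime∤1 pp p∣1 = prime≢1 pp (∣1⇒≡1 p∣1)

∤-linear-at-0-or-1 : ∀ a b → p ∤ a → ∃ λ t → p ∤ a * t + b
∤-linear-at-0-or-1 {p} a b p∤a with p ∣? b
... | no  p∤b = 0 , p∤b ∘ subst (p ∣_) (cong (_+ b) (*-zeroʳ a))
... | yes p∣b = 1 , λ p∣ → p∤a (subst (p ∣_) (*-identityʳ a)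
  (∣m+n∣n⇒∣m p∣ p∣b))

linear : ∀ a (b : ℕ) .{{_ : NonZero a}} → PositiveLinear
linear a b = record { leading = ℤ.+ a ; constant = ℤ.+ b ; leading>0 = ℤ.+<+ (>-nonZero⁻¹ a) }

eval-linear : ∀ a b .{{_ : NonZero a}} t → eval (linear a b) (ℤ.+ t) ≡ ℤ.+ (a * t + b)
eval-linear a b t = cong (ℤ._+ ℤ.+ b) (sym (ℤ.pos-* a t))

∣eval-linear : ∀ a b .{{_ : NonZero a}} t → ℤ.+ p ∣ℤ eval (linear a b) (ℤ.+ t) → p ∣ a * t + b
∣eval-linear {p} a b t = subst (ℤ.+ p ∣ℤ_) (eval-linear a b t)

primeInteger-linear : ∀ a b .{{_ : NonZero a}} t → PrimeInteger (eval (linear a b) (ℤ.+ t)) → Prime (a * t + b)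
primeInteger-linear a b t (q , q-prime , eq) =
  subst Prime (ℤ.+-injective (trans (sym eq) (eval-linear a b t))) q-prime

∤evalProduct : ∀ fs t → Prime p → All (λ f → ¬ (ℤ.+ p ∣ℤ eval f t)) fs → ¬ (ℤ.+ p ∣ℤ evalProduct fs t)
∤evalProduct []       t pp []         p∣ = prime∤1 pp p∣
∤evalProduct {p} (f ∷ fs) t pp (p∤f ∷ p∤fs) p∣ =
  [ p∤f , ∤evalProduct fs t pp p∤fs ]′
    (euclidsLemma ℤ.∣ eval f t ∣ ℤ.∣ evalProduct fs t ∣ pp
      (subst (p ∣_) (ℤ.abs-* (eval f t) (evalProduct fs t)) p∣))

-- From one solution (v, u) of 6 n q₂ = 1 + m q₁ the shifts by (6 n t, m t) give a linear family.
-- The twin primes are p = 1 + 2 m q₁ and p + 2 = 3 + 2 m q₁, and p + 1 = 12 n q₂.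
module TwinPrimeSystem
  (m n u v : ℕ) .{{_ : NonZero m}} .{{_ : NonZero n}}
  (6⊥m : Coprime 6 m) (6nu≡1+mv : 6 * n * u ≡ 1 + m * v)
  where

  q₁ q₂ : ℕ → ℕ
  q₁ t = 6 * n * t + v
  q₂ t = m * t + u

  6nq₂≡1+mq₁ : ∀ t → 6 * n * q₂ t ≡ 1 + m * q₁ t
  6nq₂≡1+mq₁ t = begin
    6 * n * (m * t + u)              ≡⟨ *-distribˡ-+ (6 * n) (m * t) u ⟩
    6 * n * (m * t) + 6 * n * u      ≡⟨ cong (6 * n * (m * t) +_) 6nu≡1+mv ⟩
    6 * n * (m * t) + (1 + m * v)    ≡⟨ collect m n t v ⟩
    1 + m * (6 * n * t + v)          ∎
    where
    open ≡-Reasoning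
    collect : ∀ m n t v → 6 * n * (m * t) + (1 + m * v) ≡ 1 + m * (6 * n * t + v)
    collect = solve-∀

  Admissible : ℕ → ℕ → Set
  Admissible q t = q ∤ q₁ t × q ∤ q₂ t × q ∤ 1 + 2 * m * q₁ t × q ∤ 3 + 2 * m * q₁ t

  -- Modulo `q`, 6 n q₂ and p are 1 and p + 2 is 3, with q ≠ 3 because 6 is coprime to `m`. Only q₁
  -- depends on the choice of t, and its slope 6 n is invertible.
  admissible-∣m : ∀ {q} → Prime q → q ∣ m → ∃ (Admissible q)
  admissible-∣m {q} pq q∣m = t , q∤q₁
    , (λ q∣q₂ → prime∤1 pq (∣m+n∣n⇒∣m (subst (q ∣_) (6nq₂≡1+mq₁ t) (∣n⇒∣m*n (6 * n) q∣q₂))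
                                        (∣m⇒∣m*n (q₁ t) q∣m)))
    , (λ q∣p → prime∤1 pq (∣m+n∣n⇒∣m q∣p q∣2mq₁))
    , (λ q∣p+2 → prime≢1 pq (6⊥m (∣n⇒∣m*n 2 (∣m+n∣n⇒∣m q∣p+2 q∣2mq₁) , q∣m)))
    where
    q∤6n : q ∤ 6 * n
    q∤6n q∣6n = prime∤1 pq (∣m+n∣n⇒∣m (subst (q ∣_) 6nu≡1+mv (∣m⇒∣m*n u q∣6n)) (∣m⇒∣m*n v q∣m))
    t : ℕ
    t = proj₁ (∤-linear-at-0-or-1 (6 * n) v q∤6n)
    q∤q₁ : q ∤ q₁ t
    q∤q₁ = proj₂ (∤-linear-at-0-or-1 (6 * n) v q∤6n)
    q∣2mq₁ : q ∣ 2 * m * q₁ t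
    q∣2mq₁ = ∣m⇒∣m*n (q₁ t) (∣n⇒∣m*n 2 q∣m)

  -- Modulo `q`, m q₁ is -1, so p is -1 and p + 2 is 1. Only q₂ depends on the choice of t, and its
  -- slope `m` is invertible.
  admissible-∣6n : ∀ {q} → Prime q → q ∤ m → q ∣ 6 * n → ∃ (Admissible q)
  admissible-∣6n {q} pq q∤m q∣6n = t
    , (λ q∣q₁ → prime∤1 pq (∣m+n∣n⇒∣m q∣1+mq₁ (∣n⇒∣m*n m q∣q₁)))
    , proj₂ (∤-linear-at-0-or-1 m u q∤m)
    , (λ q∣p → prime∤1 pq (∣m+n∣n⇒∣m (subst (q ∣_) (step₁ (m * q₁ t)) (∣n⇒∣m*n 2 q∣1+mq₁))
                                      (subst (λ e → q ∣ 1 + e) (*-assoc 2 m (q₁ t)) q∣p)))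
    , (λ q∣p+2 → prime∤1 pq (∣m+n∣n⇒∣m (subst (q ∣_) (step₂ m (q₁ t)) q∣p+2) (∣n⇒∣m*n 2 q∣1+mq₁)))
    where
    t : ℕ
    t = proj₁ (∤-linear-at-0-or-1 m u q∤m)
    q∣1+mq₁ : q ∣ 1 + m * q₁ t
    q∣1+mq₁ = subst (q ∣_) (6nq₂≡1+mq₁ t) (∣m⇒∣m*n (q₂ t) q∣6n)
    step₁ : ∀ a → 2 * (1 + a) ≡ 1 + (1 + 2 * a)
    step₁ = solve-∀
    step₂ : ∀ m a → 3 + 2 * m * a ≡ 1 + 2 * (1 + m * a)
    step₂ = solve-∀

  -- The slope A = 12 m n of 2 m q₁ is invertible modulo `q`. With inverse s the solution is t = s
  -- (1 - 2 m v), where `q-1` stands for -1.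
  2mq₁≡1-solvable : ∀ {q} → Prime q → q ∤ m → q ∤ 6 * n → ∃₂ λ t w → 2 * m * q₁ t ≡ 1 + q * w
  2mq₁≡1-solvable {zero}        pq _   _    = contradiction pq ¬prime[0]
  2mq₁≡1-solvable {q@(suc q-1)} pq q∤m q∤6n =
    let s , w , As≡1+qw = coprime⇒inverse A q {{A≢0}} (prime∤⇒coprime pq q∤A) in
    s * (1 + 2 * m * v * q-1) , w * (1 + 2 * m * v * q-1) + 2 * m * v , (begin
      2 * m * (6 * n * (s * (1 + 2 * m * v * q-1)) + v)
        ≡⟨ expand m n s v q-1 ⟩
      A * s * (1 + 2 * m * v * q-1) + 2 * m * v
        ≡⟨ cong (λ e → e * (1 + 2 * m * v * q-1) + 2 * m * v) As≡1+qw ⟩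
      (1 + q * w) * (1 + 2 * m * v * q-1) + 2 * m * v
        ≡⟨ collect m v q-1 w ⟩
      1 + q * (w * (1 + 2 * m * v * q-1) + 2 * m * v) ∎)
    where
    open ≡-Reasoning
    A : ℕ
    A = 2 * m * (6 * n)
    A≢0 : NonZero A
    A≢0 = m*n≢0 (2 * m) (6 * n) {{m*n≢0 2 m}} {{m*n≢0 6 n}}
    q∤2m : q ∤ 2 * m
    q∤2m q∣2m = [ (λ q∣2 → q∤6n (∣m⇒∣m*n n (∣m⇒∣m*n 3 q∣2))) , q∤m ]′ (euclidsLemma 2 m pq q∣2m)
    q∤A : q ∤ A
    q∤A q∣A = [ q∤2m , q∤6n ]′ (euclidsLemma (2 * m) (6 * n) pq q∣A)
    expand : ∀ m n s v q-1 → 2 * m * (6 * n * (s * (1 + 2 * m * v * q-1)) + v) ≡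
                             2 * m * (6 * n) * s * (1 + 2 * m * v * q-1) + 2 * m * v
    expand = solve-∀
    collect : ∀ m v q-1 w → (1 + suc q-1 * w) * (1 + 2 * m * v * q-1) + 2 * m * v ≡
                            1 + suc q-1 * (w * (1 + 2 * m * v * q-1) + 2 * m * v)
    collect = solve-∀

  -- If 2 m q₁ ≡ 1 modulo q, then 12 n q₂, p and p + 2 are 3, 2 and 4 modulo q.
  admissible-∤6mn : ∀ {q} → Prime q → q ∤ m → q ∤ 6 * n → ∃ (Admissible q)
  admissible-∤6mn {q} pq q∤m q∤6n = t
    , (λ q∣q₁ → prime∤1 pq (residue 0 (∣n⇒∣m*n (2 * m) q∣q₁)))
    , (λ q∣q₂ → q∤3 (residue 2 (subst (q ∣_) twice (∣n⇒∣m*n 2 (∣n⇒∣m*n (6 * n) q∣q₂)))))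
    , (λ q∣p → q∤2 (residue 1 q∣p))
    , (λ q∣p+2 → [ q∤2 , q∤2 ]′ (euclidsLemma 2 2 pq (residue 3 q∣p+2)))
    where
    solution : ∃₂ λ t w → 2 * m * q₁ t ≡ 1 + q * w
    solution = 2mq₁≡1-solvable pq q∤m q∤6n
    t w : ℕ
    t = proj₁ solution
    w = proj₁ (proj₂ solution)
    q∤2 : q ∤ 2
    q∤2 q∣2 = q∤6n (∣m⇒∣m*n n (∣m⇒∣m*n 3 q∣2))
    q∤3 : q ∤ 3
    q∤3 q∣3 = q∤6n (∣m⇒∣m*n n (∣m⇒∣m*n 2 q∣3))
    residue : ∀ r → q ∣ r + 2 * m * q₁ t → q ∣ r + 1
    residue r q∣ = ∣m+n∣n⇒∣m {n = q * w}
      (subst (q ∣_) (trans (cong (r +_) (proj₂ (proj₂ solution))) (sym (+-assoc r 1 (q * w)))) q∣)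
      (m∣m*n w)
    twice : 2 * (6 * n * q₂ t) ≡ 2 + 2 * m * q₁ t
    twice = trans (cong (2 *_) (6nq₂≡1+mq₁ t)) (distribute m (q₁ t))
      where
      distribute : ∀ m a → 2 * (1 + m * a) ≡ 2 + 2 * m * a
      distribute = solve-∀

  admissible : ∀ {q} → Prime q → ∃ (Admissible q)
  admissible {q} pq with q ∣? m | q ∣? 6 * n
  ... | yes q∣m | _        = admissible-∣m pq q∣m
  ... | no  q∤m | yes q∣6n = admissible-∣6n pq q∤m q∣6n
  ... | no  q∤m | no  q∤6n = admissible-∤6mn pq q∤m q∤6n

  private instance
    6n≢0 : NonZero (6 * n)
    6n≢0 = m*n≢0 6 n
    12mn≢0 : NonZero (2 * m * (6 * n))
    12mn≢0 = m*n≢0 (2 * m) (6 * n) {{m*n≢0 2 m}}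

  system : List PositiveLinear
  system = linear (6 * n) v ∷ linear m u
         ∷ linear (2 * m * (6 * n)) (1 + 2 * m * v) ∷ linear (2 * m * (6 * n)) (3 + 2 * m * v) ∷ []

  shift : ∀ r t → 2 * m * (6 * n) * t + (r + 2 * m * v) ≡ r + 2 * m * q₁ t
  shift r t = identity m n v r t
    where
    identity : ∀ m n v r t → 2 * m * (6 * n) * t + (r + 2 * m * v) ≡ r + 2 * m * (6 * n * t + v)
    identity = solve-∀

  system-admissible : ∀ q → Prime q → ∃ λ t → ¬ (ℤ.+ q ∣ℤ evalProduct system t)
  system-admissible q pq with admissible pq
  ... | t , q∤q₁ , q∤q₂ , q∤p , q∤p+2 = ℤ.+ t , ∤evalProduct system (ℤ.+ t) pq
    ( q∤q₁ ∘ ∣eval-linear (6 * n) v t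
    ∷ q∤q₂ ∘ ∣eval-linear m u t
    ∷ q∤p ∘ subst (q ∣_) (shift 1 t) ∘ ∣eval-linear (2 * m * (6 * n)) (1 + 2 * m * v) t
    ∷ q∤p+2 ∘ subst (q ∣_) (shift 3 t) ∘ ∣eval-linear (2 * m * (6 * n)) (3 + 2 * m * v) t
    ∷ [])

  prime-q₁ : ∀ t → PrimeInteger (eval (linear (6 * n) v) (ℤ.+ t)) → Prime (q₁ t)
  prime-q₁ t = primeInteger-linear (6 * n) v t

  prime-q₂ : ∀ t → PrimeInteger (eval (linear m u) (ℤ.+ t)) → Prime (q₂ t)
  prime-q₂ t = primeInteger-linear m u t

  prime-p : ∀ r t → PrimeInteger (eval (linear (2 * m * (6 * n)) (r + 2 * m * v)) (ℤ.+ t)) →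
            Prime (r + 2 * m * q₁ t)
  prime-p r t = subst Prime (shift r t) ∘ primeInteger-linear (2 * m * (6 * n)) (r + 2 * m * v) t

  prime-values : DicksonConjecture → ∀ N → ∃ λ t → N < q₁ t × N < q₂ t ×
    Prime (q₁ t) × Prime (q₂ t) × Prime (1 + 2 * m * q₁ t) × Prime (3 + 2 * m * q₁ t)
  prime-values dickson N = let t , N<t , primes = dickson system system-admissible N in t
    , <-≤-trans N<t (≤-trans (m≤n*m t (6 * n)) (m≤m+n (6 * n * t) v))
    , <-≤-trans N<t (≤-trans (m≤n*m t m) (m≤m+n (m * t) u))
    , prime-q₁ t (All.head primes)
    , prime-q₂ t (All.head (All.tail primes))
    , prime-p 1 t (All.head (All.tail (All.tail primes)))
    , prime-p 3 t (All.head (All.tail (All.tail (All.tail primes))))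

twin-primes-with-prime-cofactors : DicksonConjecture →
  ∀ m n .{{_ : NonZero m}} .{{_ : NonZero n}} → Coprime 6 m → Coprime (6 * n) m → ∀ N →
  ∃₂ λ q₁ q₂ → N < q₁ × N < q₂ × Prime q₁ × Prime q₂ × 6 * n * q₂ ≡ 1 + m * q₁ ×
    Prime (1 + 2 * m * q₁) × Prime (3 + 2 * m * q₁)
twin-primes-with-prime-cofactors dickson m n 6⊥m 6n⊥m N =
  let u , v , 6nu≡1+mv = coprime⇒inverse (6 * n) m {{m*n≢0 6 n}} 6n⊥m
      open TwinPrimeSystem m n u v 6⊥m 6nu≡1+mv
      t , N<q₁ , N<q₂ , Pq₁ , Pq₂ , Pp , Pp+2 = prime-values dickson N
  in q₁ t , q₂ t , N<q₁ , N<q₂ , Pq₁ , Pq₂ , 6nq₂≡1+mq₁ t , Pp , Pp+2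

-- Approximation by totients, with cleared denominators

-- Write X = 4 b m t and ρ = 4 m t / (6 n s), the limit of the totient ratio. The conclusion then
-- reads ρ ≤ a/b + 1/(2K). It holds because X exceeds Y = 6 a s n by at most Y / l.
greedy-gap : ∀ a b K l n s .{{_ : NonZero a}} .{{_ : NonZero b}} → 2 * K * a ≤ l →
  ∀ X → 6 * a * s * n ≤ X → l * X < suc l * (6 * a * s * n) →
  2 * K * X ≤ 2 * K * (6 * a * s * n) + 6 * n * b * s
greedy-gap a b K l n s 2Ka≤l X Y≤X lX<Y+lY with m≤n⇒∃[o]m+o≡n Y≤X
... | D , refl = begin
  2 * K * (Y + D)               ≡⟨ *-distribˡ-+ (2 * K) Y D ⟩
  2 * K * Y + 2 * K * D         ≤⟨ +-monoʳ-≤ (2 * K * Y) (*-cancelʳ-≤ _ _ a bound) ⟩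
  2 * K * Y + 6 * n * b * s     ∎
  where
  open ≤-Reasoning
  Y : ℕ
  Y = 6 * a * s * n
  lD≤Y : l * D ≤ Y
  lD≤Y = +-cancelˡ-≤ (l * Y) _ _ (begin
    l * Y + l * D    ≡⟨ *-distribˡ-+ l Y D ⟨
    l * (Y + D)      ≤⟨ <⇒≤ lX<Y+lY ⟩
    Y + l * Y        ≡⟨ +-comm Y (l * Y) ⟩
    l * Y + Y        ∎)
  bound : 2 * K * D * a ≤ 6 * n * b * s * a
  bound = begin
    2 * K * D * a        ≡⟨ swap (2 * K) D a ⟩
    2 * K * a * D        ≤⟨ *-monoˡ-≤ D 2Ka≤l ⟩
    l * D                ≤⟨ lD≤Y ⟩
    Y                    ≤⟨ m≤n*m Y b ⟩
    b * Y                ≡⟨ rearrange a b n s ⟩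
    6 * n * b * s * a    ∎
    where
    swap : ∀ x y z → x * y * z ≡ x * z * y
    swap = solve-∀
    rearrange : ∀ a b n s → b * (6 * a * s * n) ≡ 6 * n * b * s * a
    rearrange = solve-∀

-- With q₁ = x + 1 and q₂ = y + 1 the totient ratio is 4 t y / (s x). Since 6 n y ≤ 1 + m (x + 1),
-- it exceeds ρ = 4 m t / (6 n s) by at most 4 t (m + 1) / (6 n s x). Large x makes this at most
-- 1/(2K), and `gap` supplies the other half of 1/K.
ratio-upper : ∀ a b K m n s t x y .{{_ : NonZero b}} .{{_ : NonZero n}} .{{_ : NonZero s}} →
  6 * n * suc y ≡ 1 + m * suc x → 8 * K * t * b * suc m ≤ x →
  2 * K * (4 * b * m * t) ≤ 2 * K * (6 * a * s * n) + 6 * n * b * s →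
  K * (4 * t * y * b) ≤ K * (a * (s * x)) + b * (s * x)
ratio-upper a b K m n s t x y 6n[1+y]≡ x-large gap =
  *-cancelˡ-≤ (2 * (6 * n)) {{m*n≢0 2 (6 * n) {{_}} {{m*n≢0 6 n}}}} (begin
    2 * (6 * n) * (K * (4 * t * y * b))
      ≡⟨ expand₁ b K n t y ⟩
    8 * K * t * b * (6 * n * y)
      ≤⟨ *-monoʳ-≤ (8 * K * t * b) (≤-trans (*-monoʳ-≤ (6 * n) (n≤1+n y)) (≤-reflexive 6n[1+y]≡)) ⟩
    8 * K * t * b * (1 + m * suc x)
      ≡⟨ expand₂ b K m t x ⟩
    8 * K * t * b * suc m + 2 * K * (4 * b * m * t) * x
      ≤⟨ +-mono-≤ (≤-trans x-large (m≤n*m x (6 * n * b * s) {{6nbs≢0}})) (*-monoˡ-≤ x gap) ⟩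
    6 * n * b * s * x + (2 * K * (6 * a * s * n) + 6 * n * b * s) * x
      ≡⟨ expand₃ a b K n s x ⟩
    2 * (6 * n) * (K * (a * (s * x)) + b * (s * x)) ∎)
  where
  open ≤-Reasoning
  6nbs≢0 : NonZero (6 * n * b * s)
  6nbs≢0 = m*n≢0 (6 * n * b) s {{m*n≢0 (6 * n) b {{m*n≢0 6 n}}}}
  expand₁ : ∀ b K n t y → 2 * (6 * n) * (K * (4 * t * y * b)) ≡ 8 * K * t * b * (6 * n * y)
  expand₁ = solve-∀
  expand₂ : ∀ b K m t x → 8 * K * t * b * (1 + m * suc x) ≡
                          8 * K * t * b * suc m + 2 * K * (4 * b * m * t) * x
  expand₂ = solve-∀
  expand₃ : ∀ a b K n s x → 6 * n * b * s * x + (2 * K * (6 * a * s * n) + 6 * n * b * s) * x ≡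
                            2 * (6 * n) * (K * (a * (s * x)) + b * (s * x))
  expand₃ = solve-∀

-- Here ρ = 4 m t / (6 n s) is at least a/b by `above`. Passing from q₂ = y + 1 to y costs 4 t / (s
-- x), at most 1/K for large x.
ratio-lower : ∀ a b K m n s t x y .{{_ : NonZero n}} .{{_ : NonZero s}} →
  6 * n * suc y ≡ 1 + m * suc x → 4 * K * t ≤ x → 6 * a * s * n ≤ 4 * b * m * t →
  K * (a * (s * x)) ≤ K * (4 * t * y * b) + b * (s * x)
ratio-lower a b K m n s t x y 6n[1+y]≡ x-large above =
  *-cancelˡ-≤ (6 * n) {{m*n≢0 6 n}} (begin
    6 * n * (K * (a * (s * x)))
      ≡⟨ expand₁ a K n s x ⟩
    K * x * (6 * a * s * n)
      ≤⟨ *-monoʳ-≤ (K * x) above ⟩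
    K * x * (4 * b * m * t)
      ≤⟨ m≤m+n _ (4 * K * t * b * suc m) ⟩
    K * x * (4 * b * m * t) + 4 * K * t * b * suc m
      ≡⟨ expand₂ b K m t x ⟩
    4 * K * t * b * (1 + m * suc x)
      ≡⟨ cong (4 * K * t * b *_) 6n[1+y]≡ ⟨
    4 * K * t * b * (6 * n * suc y)
      ≡⟨ expand₃ b K n t y ⟩
    6 * n * (K * (4 * t * y * b)) + 6 * n * b * (4 * K * t)
      ≤⟨ +-monoʳ-≤ _ (*-monoʳ-≤ (6 * n * b) (≤-trans x-large (m≤n*m x s))) ⟩
    6 * n * (K * (4 * t * y * b)) + 6 * n * b * (s * x)
      ≡⟨ expand₄ b (K * (4 * t * y * b)) n (s * x) ⟩
    6 * n * (K * (4 * t * y * b) + b * (s * x)) ∎)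
  where
  open ≤-Reasoning
  expand₁ : ∀ a K n s x → 6 * n * (K * (a * (s * x))) ≡ K * x * (6 * a * s * n)
  expand₁ = solve-∀
  expand₂ : ∀ b K m t x → K * x * (4 * b * m * t) + 4 * K * t * b * suc m ≡
                          4 * K * t * b * (1 + m * suc x)
  expand₂ = solve-∀
  expand₃ : ∀ b K n t y → 4 * K * t * b * (6 * n * suc y) ≡
                          6 * n * (K * (4 * t * y * b)) + 6 * n * b * (4 * K * t)
  expand₃ = solve-∀
  expand₄ : ∀ b e n f → 6 * n * e + 6 * n * b * f ≡ 6 * n * (e + b * f)
  expand₄ = solve-∀

-- Totients of p - 1 and p + 1, and the choice of m and n

distinct-∣ : ∀ {c e} → e ∣ c → DistinctPrimes∤ c ps → DistinctPrimes∤ e ps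
distinct-∣ e∣c []              = []
distinct-∣ e∣c (_∷_ {ps = ps} (pp , p∤) ds) =
  (pp , λ p∣ → p∤ (∣-trans p∣ (*-monoʳ-∣ (product ps) e∣c))) ∷ distinct-∣ e∣c ds

φ-prime-*-large : ∀ {q} → .{{NonZero n}} → Prime q → n < q → φ (q * n) ≡ φ n * pred q
φ-prime-*-large {n} {q} q-prime n<q = trans (φ-prime-* q-prime (>⇒∤ n<q)) (*-comm (pred q) (φ n))

-- p + 1 = 12 n q₂ and p - 1 = 2 m q₁, with q₁ and q₂ too large to divide their cofactors. These are
-- written `n * 12` and `m * 2` to fit `φ-product-*`.
totients-beside-p : ∀ m n {q₁ q₂} .{{_ : NonZero m}} .{{_ : NonZero n}} →
  Prime q₁ → Prime q₂ → m * 2 < q₁ → n * 12 < q₂ → 6 * n * q₂ ≡ 1 + m * q₁ →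
  φ (1 + 2 * m * q₁ + 1) ≡ φ (n * 12) * pred q₂ × φ (2 * m * q₁) ≡ φ (m * 2) * pred q₁
totients-beside-p m n {q₁} {q₂} q₁-prime q₂-prime 2m<q₁ 12n<q₂ 6nq₂≡1+mq₁ =
    trans (cong φ p+1≡) (φ-prime-*-large {{m*n≢0 n 12}} q₂-prime 12n<q₂)
  , trans (cong φ (rotate m q₁)) (φ-prime-*-large {{m*n≢0 m 2}} q₁-prime 2m<q₁)
  where
  open ≡-Reasoning
  double : ∀ m q → 1 + 2 * m * q + 1 ≡ 2 * (1 + m * q)
  double = solve-∀
  rearrange : ∀ n q → 2 * (6 * n * q) ≡ q * (n * 12)
  rearrange = solve-∀
  rotate : ∀ m q → 2 * m * q ≡ q * (m * 2)
  rotate = solve-∀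
  p+1≡ : 1 + 2 * m * q₁ + 1 ≡ q₂ * (n * 12)
  p+1≡ = begin
    1 + 2 * m * q₁ + 1    ≡⟨ double m q₁ ⟩
    2 * (1 + m * q₁)      ≡⟨ cong (2 *_) 6nq₂≡1+mq₁ ⟨
    2 * (6 * n * q₂)      ≡⟨ rearrange n q₂ ⟩
    q₂ * (n * 12)         ∎

-- Their product m has m/φ(m) ≥ 2 a, so with n = 1 the limiting ratio (2/3) m/φ(m) is at least 4 a /
-- 3 and exceeds the target a/b.
initial-primes : ∀ a → ∃ λ ps → DistinctPrimes∤ 12 ps × 2 * a * ∏pred ps ≤ product ps
initial-primes a = let k , sparse = primesAbove-sparse 12 (2 * a) in
  primesAbove 12 k , primesAbove-distinct ≤-refl k , sparse

-- All primes of a long interval together would push the ratio 4 m t / (6 n s) below a/b; `greedy`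
-- drops some until it is just above.
further-primes : ∀ a b K m s
  .{{_ : NonZero a}} .{{_ : NonZero b}} .{{m≢0 : NonZero m}} .{{s≢0 : NonZero s}} →
  2 * a * s ≤ m → ∃₂ λ l ps → 2 * K * a ≤ l × DistinctPrimes∤ (12 * m) ps ×
    6 * a * s * product ps ≤ 4 * b * m * ∏pred ps ×
    l * (4 * b * m * ∏pred ps) < suc l * (6 * a * s * product ps)
further-primes a b K m s 2as≤m =
  let k , sparse = primesAbove-sparse L (suc X) in
  unpack (greedy (primesAbove-distinct {{m*n≢0 12 m}} (m≤m+n (12 * m) (2 * K * a)) k)
                 (primesAbove-> L k) Y≤X (X<Y (primesAbove-prime L k) sparse))
  where
  open ≤-Reasoning
  L X Y : ℕ
  -- Primes above 12 m cannot divide 12 m, and the summand 2 K a becomes the lower bound on `l`.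
  L = 12 * m + 2 * K * a
  X = 4 * b * m
  Y = 6 * a * s
  Y≢0 : NonZero Y
  Y≢0 = m*n≢0 (6 * a) s {{m*n≢0 6 a}}
  Y≤X : Y ≤ X
  Y≤X = begin
    6 * a * s          ≡⟨ triple a s ⟩
    3 * (2 * a * s)    ≤⟨ *-mono-≤ {3} {4} (n≤1+n 3) 2as≤m ⟩
    4 * m              ≤⟨ *-monoˡ-≤ m (m≤m*n 4 b) ⟩
    4 * b * m          ∎
    where
    triple : ∀ a s → 6 * a * s ≡ 3 * (2 * a * s)
    triple = solve-∀
  X<Y : ∀ {ps} → All Prime ps → suc X * ∏pred ps ≤ product ps → X * ∏pred ps < Y * product ps
  X<Y {ps} primes sparse = begin
    1 + X * ∏pred ps           ≤⟨ +-monoˡ-≤ (X * ∏pred ps) (>-nonZero⁻¹ (∏pred ps) {{primes⇒∏pred≢0 primes}}) ⟩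
    ∏pred ps + X * ∏pred ps    ≤⟨ sparse ⟩
    product ps                 ≤⟨ m≤n*m (product ps) Y {{Y≢0}} ⟩
    Y * product ps             ∎
  rotate : ∀ x y z → x * (y * z) ≡ y * (x * z)
  rotate = solve-∀
  unpack : (∃₂ λ p ps → L < p × DistinctPrimes∤ (12 * m) ps ×
             Y * product ps ≤ X * ∏pred ps × X * ∏pred (p ∷ ps) < Y * product (p ∷ ps)) →
           ∃₂ λ l ps → 2 * K * a ≤ l × DistinctPrimes∤ (12 * m) ps ×
             Y * product ps ≤ X * ∏pred ps × l * (X * ∏pred ps) < suc l * (Y * product ps)
  -- The last prime dropped is l + 1, so its factor p/(p - 1) is (l + 1)/l.
  unpack (suc l , ps , L<1+l , distinct , above , below) =
    l , ps , ≤-trans (m≤n+m (2 * K * a) (12 * m)) (s≤s⁻¹ L<1+l) , distinct , above ,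
    subst₂ _<_ (rotate X l (∏pred ps)) (rotate Y (suc l) (product ps)) below

-- For positive `b` and `K`, the distance of φ(p+1)/φ(p-1) from a/b is at most 1/K, with
-- denominators cleared.
TwinPrimeTotientsNear : (a b K : ℕ) → Set
TwinPrimeTotientsNear a b K = ∃ λ p → Prime p × Prime (p + 2) ×
  K * (φ (p + 1) * b) ≤ K * (a * φ (p ∸ 1)) + b * φ (p ∸ 1) ×
  K * (a * φ (p ∸ 1)) ≤ K * (φ (p + 1) * b) + b * φ (p ∸ 1)

totients-near-from-factors : DicksonConjecture →
  ∀ a b K l m n s t .{{_ : NonZero a}} .{{_ : NonZero b}}
    .{{m≢0 : NonZero m}} .{{n≢0 : NonZero n}} .{{s≢0 : NonZero s}} →
  Coprime 6 m → Coprime (6 * n) m → φ (m * 2) ≡ s → φ (n * 12) ≡ 4 * t → 2 * K * a ≤ l →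
  6 * a * s * n ≤ 4 * b * m * t → l * (4 * b * m * t) < suc l * (6 * a * s * n) →
  TwinPrimeTotientsNear a b K
totients-near-from-factors dickson a b K l m n s t 6⊥m 6n⊥m φ2m φ12n 2Ka≤l above below =
  conclude (twin-primes-with-prime-cofactors dickson m n 6⊥m 6n⊥m N)
  where
  N : ℕ
  -- The first two summands keep q₁ and q₂ from dividing their cofactors; the others are the bounds
  -- on x in `ratio-upper` and `ratio-lower`.
  N = m * 2 + n * 12 + (8 * K * t * b * suc m + 4 * K * t)

  bounds : ∀ x y → 6 * n * suc y ≡ 1 + m * suc x → 8 * K * t * b * suc m + 4 * K * t ≤ x →
    K * (4 * t * y * b) ≤ K * (a * (s * x)) + b * (s * x) ×
    K * (a * (s * x)) ≤ K * (4 * t * y * b) + b * (s * x)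
  bounds x y 6n[1+y]≡ x-large =
      ratio-upper a b K m n s t x y 6n[1+y]≡
        (≤-trans (m≤m+n (8 * K * t * b * suc m) (4 * K * t)) x-large)
        (greedy-gap a b K l n s 2Ka≤l (4 * b * m * t) above below)
    , ratio-lower a b K m n s t x y 6n[1+y]≡
        (≤-trans (m≤n+m (4 * K * t) (8 * K * t * b * suc m)) x-large) above

  conclude : (∃₂ λ q₁ q₂ → N < q₁ × N < q₂ × Prime q₁ × Prime q₂ × 6 * n * q₂ ≡ 1 + m * q₁ ×
    Prime (1 + 2 * m * q₁) × Prime (3 + 2 * m * q₁)) → TwinPrimeTotientsNear a b K
  conclude (suc x , suc y , N<q₁ , N<q₂ , q₁-prime , q₂-prime , 6nq₂≡ , p-prime , p+2-prime) =
    1 + 2 * m * suc x , p-prime , subst Prime (+-comm 2 (1 + 2 * m * suc x)) p+2-prime ,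
    subst₂ (λ f g → K * (f * b) ≤ K * (a * g) + b * g × K * (a * g) ≤ K * (f * b) + b * g)
      (sym (trans (proj₁ totients) (cong (_* y) φ12n)))
      (sym (trans (proj₂ totients) (cong (_* x) φ2m)))
      (bounds x y 6nq₂≡ (≤-trans (m≤n+m _ (m * 2 + n * 12)) (s≤s⁻¹ N<q₁)))
    where
    totients : φ (1 + 2 * m * suc x + 1) ≡ φ (n * 12) * y × φ (2 * m * suc x) ≡ φ (m * 2) * x
    totients = totients-beside-p m n q₁-prime q₂-prime
      (≤-<-trans (≤-trans (m≤m+n (m * 2) (n * 12)) (m≤m+n _ _)) N<q₁)
      (≤-<-trans (≤-trans (m≤n+m (n * 12) (m * 2)) (m≤m+n _ _)) N<q₂) 6nq₂≡

twin-prime-totients-near : DicksonConjecture → ∀ a b K .{{_ : NonZero a}} .{{_ : NonZero b}} →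
                           TwinPrimeTotientsNear a b K
twin-prime-totients-near dickson a b K =
  let ps , ps-distinct , sparse = initial-primes a
      ps-prime = distinct⇒prime ps-distinct
      m≢0 = primes⇒product≢0 ps-prime
      s≢0 = primes⇒∏pred≢0 ps-prime
      6⊥m = coprime-∣ (divides 2 refl) (coprime-product ps-distinct)
      l , qs , 2Ka≤l , qs-distinct , above , below =
        further-primes a b K (product ps) (∏pred ps) {{m≢0 = m≢0}} {{s≢0 = s≢0}} sparse
  in totients-near-from-factors dickson a b K l (product ps) (product qs) (∏pred ps) (∏pred qs)
    {{m≢0 = m≢0}} {{primes⇒product≢0 (distinct⇒prime qs-distinct)}} {{s≢0}}
    6⊥m
    (Coprimality.sym (coprime-*ʳ (Coprimality.sym 6⊥m)
      (coprime-∣ (n∣m*n 12) (coprime-product qs-distinct))))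
    (trans (φ-product-* (distinct-∣ (divides 6 refl) ps-distinct)) (*-identityʳ (∏pred ps)))
    (trans (φ-product-* (distinct-∣ (m∣m*n (product ps)) qs-distinct)) (*-comm (∏pred qs) 4))
    2Ka≤l above below

-- Rational and real approximation

infixl 7 _/ℚ_

_/ℚ_ : ℕ → (n : ℕ) .{{_ : NonZero n}} → ℚ
m /ℚ n = ℤ.+ m ℚ./ n

toℚᵘ-/ : ∀ m n-1 → ℚ.toℚᵘ (m /ℚ suc n-1) ℚᵘ.≃ mkℚᵘ (ℤ.+ m) n-1
toℚᵘ-/ m n-1 = ℚ.toℚᵘ-fromℚᵘ (mkℚᵘ (ℤ.+ m) n-1)

toℚᵘ-/-+ : ∀ a b-1 c d-1 → ℚ.toℚᵘ (a /ℚ suc b-1 ℚ.+ c /ℚ suc d-1) ℚᵘ.≃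
                           mkℚᵘ (ℤ.+ a) b-1 ℚᵘ.+ mkℚᵘ (ℤ.+ c) d-1
toℚᵘ-/-+ a b-1 c d-1 = ℚᵘ.≃-trans (ℚ.toℚᵘ-homo-+ (a /ℚ suc b-1) (c /ℚ suc d-1))
  (ℚᵘ.+-cong (toℚᵘ-/ a b-1) (toℚᵘ-/ c d-1))

pos-cross-+ : ∀ a b c d e →
  (ℤ.+ a ℤ.* ℤ.+ d ℤ.+ ℤ.+ c ℤ.* ℤ.+ b) ℤ.* ℤ.+ e ≡ ℤ.+ ((a * d + c * b) * e)
pos-cross-+ a b c d e = trans
  (cong (ℤ._* ℤ.+ e) (cong₂ ℤ._+_ (sym (ℤ.pos-* a d)) (sym (ℤ.pos-* c b))))
  (sym (ℤ.pos-* (a * d + c * b) e))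

/-+-/ : ∀ i j n → i /ℚ suc n ℚ.+ j /ℚ suc n ≡ (i + j) /ℚ suc n
/-+-/ i j n = ℚ.toℚᵘ-injective (ℚᵘ.≃-trans (toℚᵘ-/-+ i n j n)
  (ℚᵘ.≃-trans (ℚᵘ.*≡* (trans (pos-cross-+ i (suc n) j (suc n) (suc n))
    (trans (cong ℤ.+_ (common i j (suc n))) (ℤ.pos-* (i + j) (suc n * suc n)))))
    (ℚᵘ.≃-sym (toℚᵘ-/ (i + j) n))))
  where
  common : ∀ i j n → (i * n + j * n) * n ≡ (i + j) * (n * n)
  common = solve-∀

-- Turns one half of `TwinPrimeTotientsNear` into an inequality in ℚ; with the two fractions
-- exchanged it handles the other half.
/-≤-/-+-1/ : ∀ f g a b K .{{_ : NonZero g}} .{{_ : NonZero b}} .{{_ : NonZero K}} →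
  K * (f * b) ≤ K * (a * g) + b * g → f /ℚ g ℚ.≤ a /ℚ b ℚ.+ 1 /ℚ K
/-≤-/-+-1/ f g@(suc g-1) a b@(suc b-1) K@(suc K-1) Kfb≤ = ℚ.toℚᵘ-cancel-≤
  (ℚᵘ.≤-respʳ-≃ (ℚᵘ.≃-sym (toℚᵘ-/-+ a b-1 1 K-1))
    (ℚᵘ.≤-respˡ-≃ (ℚᵘ.≃-sym (toℚᵘ-/ f g-1))
      (ℚᵘ.*≤* (subst₂ ℤ._≤_ (ℤ.pos-* f (b * K)) (sym (pos-cross-+ a b 1 K g)) (ℤ.+≤+ cross)))))
  where
  open ≤-Reasoning
  cross : f * (b * K) ≤ (a * K + 1 * b) * g
  cross = begin
    f * (b * K)            ≡⟨ expandˡ f b K ⟩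
    K * (f * b)            ≤⟨ Kfb≤ ⟩
    K * (a * g) + b * g    ≡⟨ expandʳ a b g K ⟩
    (a * K + 1 * b) * g    ∎
    where
    expandˡ : ∀ f b K → f * (b * K) ≡ K * (f * b)
    expandˡ = solve-∀
    expandʳ : ∀ a b g K → K * (a * g) + b * g ≡ (a * K + 1 * b) * g
    expandʳ = solve-∀

positive⇒fraction : ∀ {c} → 0ℚ ℚ.< c → ∃₂ λ a b → c ≡ suc a /ℚ suc b
positive⇒fraction {c} 0<c = fraction c (ℚ.positive 0<c)
  where
  fraction : ∀ c → ℚ.Positive c → ∃₂ λ a b → c ≡ suc a /ℚ suc b
  fraction (mkℚ (ℤ.+ suc a) b c⊥) _ = a , b , sym (ℚ.↥p/↧p≡p (mkℚ (ℤ.+ suc a) b c⊥))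

-- The 6 is 4 + 2: a totient ratio is found within 4/(n+1) of the n-th approximation, and `∣_-_∣<_`
-- demands a further 2/(n+1).
6/-<-positive : ∀ {ε} → 0ℚ ℚ.< ε → ∃ λ n → 6 /ℚ suc n ℚ.< ε
6/-<-positive {ε} 0<ε with positive⇒fraction 0<ε
... | a , b , refl = 6 * suc b , ℚ.toℚᵘ-cancel-<
  (ℚᵘ.<-respʳ-≃ (ℚᵘ.≃-sym (toℚᵘ-/ (suc a) b))
    (ℚᵘ.<-respˡ-≃ (ℚᵘ.≃-sym (toℚᵘ-/ 6 (6 * suc b)))
      (ℚᵘ.*<* (subst₂ ℤ._<_ (ℤ.pos-* 6 (suc b)) (ℤ.pos-* (suc a) (suc (6 * suc b)))
        (ℤ.+<+ (m≤n*m (suc (6 * suc b)) (suc a)))))))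

0≤/ : ∀ m n .{{_ : NonZero n}} → 0ℚ ℚ.≤ m /ℚ n
0≤/ m n = ℚ.nonNegative⁻¹ (m /ℚ n) {{ℚ.normalize-nonNeg m n}}

p≤∣p∣ : ∀ p → p ℚ.≤ ℚ.∣ p ∣
p≤∣p∣ p with ℚ.≤-total 0ℚ p
... | inj₁ 0≤p = ℚ.≤-reflexive (sym (ℚ.0≤p⇒∣p∣≡p 0≤p))
... | inj₂ p≤0 = ℚ.≤-trans p≤0 (ℚ.0≤∣p∣ p)

∣∣-≤ : ∀ {p r} → p ℚ.≤ r → ℚ.- p ℚ.≤ r → ℚ.∣ p ∣ ℚ.≤ r
∣∣-≤ {p} {r} p≤r -p≤r with ℚ.∣p∣≡p∨∣p∣≡-p p
... | inj₁ eq = subst (ℚ._≤ r) (sym eq) p≤r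
... | inj₂ eq = subst (ℚ._≤ r) (sym eq) -p≤r

≤-+⇒-≤ : ∀ {p q r} → p ℚ.≤ q ℚ.+ r → p ℚ.- q ℚ.≤ r
≤-+⇒-≤ {p} {q} {r} p≤q+r = subst (p ℚ.- q ℚ.≤_)
  (solve 2 (λ q r → (q :+ r) :- q := r) refl q r) (ℚ.+-monoˡ-≤ (ℚ.- q) p≤q+r)
  where open +-*-Solver

-≤⇒≤-+ : ∀ {p q r} → p ℚ.- q ℚ.≤ r → p ℚ.≤ q ℚ.+ r
-≤⇒≤-+ {p} {q} {r} p-q≤r = subst (ℚ._≤ q ℚ.+ r)
  (solve 2 (λ p q → q :+ (p :- q) := p) refl p q) (ℚ.+-monoʳ-≤ q p-q≤r)
  where open +-*-Solver

≃-fromℚ⇒≤ : ∀ {y r} → 0ℚ ℚ.≤ r → y ≃ fromℚ r → fromℚ 0ℚ Defs.≤ y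
≃-fromℚ⇒≤ {y} {r} 0≤r y≃r n = ℚ.≤-trans 0≤r (-≤⇒≤-+ {r} {approx y n} (begin
  r ℚ.- approx y n              ≤⟨ p≤∣p∣ _ ⟩
  ℚ.∣ r ℚ.- approx y n ∣        ≡⟨ ℚ.∣-p∣≡∣p∣ (r ℚ.- approx y n) ⟨
  ℚ.∣ ℚ.- (r ℚ.- approx y n) ∣  ≡⟨ cong ℚ.∣_∣ (solve 2 (λ r y → :- (r :- y) := y :- r) refl r (approx y n)) ⟩
  ℚ.∣ approx y n ℚ.- r ∣        ≤⟨ y≃r n ⟩
  2 /ℚ suc n                    ∎))
  where
  open ℚ.≤-Reasoning
  open +-*-Solver

≃-refl : ∀ y → y ≃ y
≃-refl y n = subst (ℚ._≤ 2 /ℚ suc n) (cong ℚ.∣_∣ (sym (ℚ.+-inverseʳ (approx y n)))) (0≤/ 2 (suc n))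

-- The target is moved up from the n-th approximation y to y + 3/(n+1), which
-- is positive although y itself may be as small as −2/(n+1).
ratio-near-nonNegative : DicksonConjecture → ∀ y n → 0ℚ ℚ.≤ y ℚ.+ 2 /ℚ suc n →
  ∃ λ p → Σ (Prime p) λ pp → Prime (p + 2) × ℚ.∣ y ℚ.- totientRatio p pp ∣ ℚ.≤ 4 /ℚ suc n
ratio-near-nonNegative dickson y n 0≤y+2δ = from-fraction (positive⇒fraction 0<c)
  where
  open ℚ.≤-Reasoning
  open +-*-Solver
  c : ℚ
  c = y ℚ.+ 3 /ℚ suc n
  0<c : 0ℚ ℚ.< c
  0<c = begin-strict
    0ℚ                                    ≤⟨ 0≤y+2δ ⟩
    y ℚ.+ 2 /ℚ suc n                      ≡⟨ ℚ.+-identityʳ _ ⟨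
    y ℚ.+ 2 /ℚ suc n ℚ.+ 0ℚ               <⟨ ℚ.+-monoʳ-< (y ℚ.+ 2 /ℚ suc n)
                                              (ℚ.positive⁻¹ (1 /ℚ suc n) {{ℚ.normalize-pos 1 (suc n)}}) ⟩
    y ℚ.+ 2 /ℚ suc n ℚ.+ 1 /ℚ suc n       ≡⟨ ℚ.+-assoc y (2 /ℚ suc n) (1 /ℚ suc n) ⟩
    y ℚ.+ (2 /ℚ suc n ℚ.+ 1 /ℚ suc n)     ≡⟨ cong (y ℚ.+_) (/-+-/ 2 1 n) ⟩
    c                                     ∎
  -- The shift 3/(n+1) from y to `c` and the tolerance 1/K with K = n + 1 add up to 4/(n+1).
  near : ∀ {r} → r ℚ.≤ c ℚ.+ 1 /ℚ suc n → c ℚ.≤ r ℚ.+ 1 /ℚ suc n → ℚ.∣ y ℚ.- r ∣ ℚ.≤ 4 /ℚ suc n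
  near {r} r≤c+δ c≤r+δ = ∣∣-≤ (≤-+⇒-≤ {y} {r} (begin
      y                      ≡⟨ ℚ.+-identityʳ y ⟨
      y ℚ.+ 0ℚ               ≤⟨ ℚ.+-monoʳ-≤ y (0≤/ 3 (suc n)) ⟩
      c                      ≤⟨ c≤r+δ ⟩
      r ℚ.+ 1 /ℚ suc n       ≡⟨ cong (r ℚ.+_) (ℚ.+-identityʳ _) ⟨
      r ℚ.+ (1 /ℚ suc n ℚ.+ 0ℚ)               ≤⟨ ℚ.+-monoʳ-≤ r (ℚ.+-monoʳ-≤ (1 /ℚ suc n) (0≤/ 3 (suc n))) ⟩
      r ℚ.+ (1 /ℚ suc n ℚ.+ 3 /ℚ suc n)       ≡⟨ cong (r ℚ.+_) (/-+-/ 1 3 n) ⟩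
      r ℚ.+ 4 /ℚ suc n       ∎))
    (subst (ℚ._≤ 4 /ℚ suc n) (solve 2 (λ r y → r :- y := :- (y :- r)) refl r y) (≤-+⇒-≤ {r} {y} (begin
      r                                      ≤⟨ r≤c+δ ⟩
      y ℚ.+ 3 /ℚ suc n ℚ.+ 1 /ℚ suc n        ≡⟨ ℚ.+-assoc y (3 /ℚ suc n) (1 /ℚ suc n) ⟩
      y ℚ.+ (3 /ℚ suc n ℚ.+ 1 /ℚ suc n)      ≡⟨ cong (y ℚ.+_) (/-+-/ 3 1 n) ⟩
      y ℚ.+ 4 /ℚ suc n                       ∎)))
  from-totients : ∀ a b → c ≡ suc a /ℚ suc b → TwinPrimeTotientsNear (suc a) (suc b) (suc n) →
    ∃ λ p → Σ (Prime p) λ pp → Prime (p + 2) × ℚ.∣ y ℚ.- totientRatio p pp ∣ ℚ.≤ 4 /ℚ suc n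
  from-totients a b c≡ (p , pp , p+2-prime , upper , lower) =
    p , pp , p+2-prime , near
      (subst (λ e → totientRatio p pp ℚ.≤ e ℚ.+ 1 /ℚ suc n) (sym c≡)
        (/-≤-/-+-1/ (φ (p + 1)) (φ (p ∸ 1)) (suc a) (suc b) (suc n) upper))
      (subst (λ e → e ℚ.≤ totientRatio p pp ℚ.+ 1 /ℚ suc n) (sym c≡)
        (/-≤-/-+-1/ (suc a) (suc b) (φ (p + 1)) (φ (p ∸ 1)) (suc n)
          (subst (λ e → suc n * (suc a * φ (p ∸ 1)) ≤ suc n * (φ (p + 1) * suc b) + e)
            (*-comm (suc b) (φ (p ∸ 1))) lower)))
    where instance _ = φ[p∸1]-nonZero pp
  from-fraction : (∃₂ λ a b → c ≡ suc a /ℚ suc b) → ∃ λ p → Σ (Prime p) λ pp →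
    Prime (p + 2) × ℚ.∣ y ℚ.- totientRatio p pp ∣ ℚ.≤ 4 /ℚ suc n
  from-fraction (a , b , c≡) =
    from-totients a b c≡ (twin-prime-totients-near dickson (suc a) (suc b) (suc n))

theorem1 : DicksonConjecture → TwinPrimeTotientRatios IsDenseIn [0,∞⟩
theorem1 dickson = (λ {y} → nonNegative y) , λ x 0≤x ε 0<ε → dense x 0≤x ε (6/-<-positive 0<ε)
  where
  open ℚ.≤-Reasoning

  nonNegative : ∀ y → TwinPrimeTotientRatios y → [0,∞⟩ y
  nonNegative y (p , pp , _ , y≃r) = ≃-fromℚ⇒≤ {y} {totientRatio p pp}
    (0≤/ (φ (p + 1)) (φ (p ∸ 1)) {{φ[p∸1]-nonZero pp}}) y≃r

  realise : ∀ x n {ε} → 6 /ℚ suc n ℚ.< ε →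
    (∃ λ p → Σ (Prime p) λ pp → Prime (p + 2) ×
      ℚ.∣ approx x n ℚ.- totientRatio p pp ∣ ℚ.≤ 4 /ℚ suc n) →
    ∃ λ y → TwinPrimeTotientRatios y × ∣ x - y ∣< ε
  realise x n {ε} 6/n<ε (p , pp , p+2-prime , near) =
    fromℚ r , (p , pp , p+2-prime , ≃-refl (fromℚ r)) , n , (begin-strict
      ℚ.∣ approx x n ℚ.- r ∣ ℚ.+ 2 /ℚ suc n    ≤⟨ ℚ.+-monoˡ-≤ (2 /ℚ suc n) near ⟩
      4 /ℚ suc n ℚ.+ 2 /ℚ suc n                ≡⟨ /-+-/ 4 2 n ⟩
      6 /ℚ suc n                               <⟨ 6/n<ε ⟩
      ε                                        ∎)
    where
    r : ℚ
    r = totientRatio p pp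

  dense : ∀ x → [0,∞⟩ x → ∀ ε → (∃ λ n → 6 /ℚ suc n ℚ.< ε) →
          ∃ λ y → TwinPrimeTotientRatios y × ∣ x - y ∣< ε
  dense x 0≤x ε (n , 6/n<ε) =
    realise x n 6/n<ε (ratio-near-nonNegative dickson (approx x n) n (0≤x n))
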